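{- Let $\mathcal{G}$ be a finite triangulation of the sphere whose faces are properly $2$-coloured black and white, and let $V=R\cup C\cup S$ be a proper vertex $3$-colouring (every triangle has exactly one vertex in each of $R,C,S$), with $R=\{r_1,\dots,r_k\}$. Define the $k\times k$ integer matrix $T=(t_{ij})$ by: for $i\neq j$, $t_{ij}$ is the number of edges $e$ with one end in $C$ and one in $S$ such that the white triangle containing $e$ has vertex $r_j$ and the black triangle containing $e$ has vertex $r_i$; and $t_{ii}=-\sum_{j\ne i}t_{ij}$. Let $\mathcal{B}_W$ be the abelian group generated by $x_1,\dots,x_k$ subject to $\sum_{j=1}^k t_{ij}x_j=0$ for $1\le i\le k$. Let $D$ be the directed multigraph on vertices $z_1,\dots,z_k$ with exactly $t_{ij}$ directed edges from $z_j$ to $z_i$ for each $i\neq j$, and let $d$ be the tree number of $D$. Then $d\neq 0$, and $\mathcal{B}_W\cong\mathbb{Z}\oplus\mathcal{C}$ where $\mathcal{C}$ is a finite abelian group of order $d$ (namely $\mathcal{C}$ is the kernel of the homomorphism $\mathcal{B}_W\to\mathbb{Z}$, $\sum_i a_ix_i\mapsto\sum_i a_i$).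
   Context: A triangulation of the sphere is a $2$-cell embedding of a finite graph (multiple edges allowed, no loops) in the sphere in which every face is bounded by a $3$-cycle with three distinct vertices; "properly $2$-coloured" means no two faces of the same colour share an edge. An arborescence in $D$ diverging from a vertex $z$ is a directed subtree of $D$ containing $z$ with all edges oriented away from $z$. The tree number of $D$ is the number of spanning arborescences of $D$ diverging from $z$; for the digraph $D$ here this number does not depend on the choice of the vertex $z$. -}

module Defs where

open import Level using (0ℓ)
open import Data.Bool.Base using (Bool; true; false; if_then_else_; _∧_)
open import Data.Nat.Base as ℕ using (ℕ; zero; suc)
open import Data.Integer.Base as ℤ using (ℤ; _+_; _*_; -_; _-_; 0ℤ)
import Data.Integer.Properties as ℤP
open import Data.Integer.Tactic.RingSolver using (solve-∀)
open import Data.Fin.Base using (Fin; zero; suc)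
open import Data.Fin.Properties using (_≟_)
open import Data.Fin.Permutation using (Permutation′; _⟨$⟩ʳ_; _⟨$⟩ˡ_)
open import Data.Product.Base using (Σ; ∃; _×_; _,_; proj₁; proj₂)
open import Data.List.Base using (List; []; _∷_; concatMap; map; allFin)
open import Function.Base using (_∘_)
open import Relation.Nullary.Decidable using (⌊_⌋)
open import Relation.Binary.PropositionalEquality
open import Algebra.Bundles using (AbelianGroup)
open import Algebra.Structures using (IsAbelianGroup)

sumℕ : ∀ {n} → (Fin n → ℕ) → ℕ
sumℕ {zero} f = 0
sumℕ {suc n} f = f zero ℕ.+ sumℕ (f ∘ suc)

prodℕ : ∀ {n} → (Fin n → ℕ) → ℕ
prodℕ {zero} f = 1
prodℕ {suc n} f = f zero ℕ.* prodℕ (f ∘ suc)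

sumℤ : ∀ {n} → (Fin n → ℤ) → ℤ
sumℤ {zero} f = 0ℤ
sumℤ {suc n} f = f zero + sumℤ (f ∘ suc)

countFin : ∀ {n} → (Fin n → Bool) → ℕ
countFin P = sumℕ (λ x → if P x then 1 else 0)

allTrue : ∀ {n} → (Fin n → Bool) → Bool
allTrue {zero} P = true
allTrue {suc n} P = P zero ∧ allTrue (P ∘ suc)

sumList : List ℕ → ℕ
sumList [] = 0
sumList (x ∷ xs) = x ℕ.+ sumList xs

consFun : ∀ {n k} → Fin k → (Fin n → Fin k) → Fin (suc n) → Fin k
consFun x f zero = x
consFun x f (suc i) = f i

allFunctions : (n k : ℕ) → List (Fin n → Fin k)
allFunctions zero k = (λ ()) ∷ []
allFunctions (suc n) k = concatMap (λ f → map (λ x → consFun x f) (allFin k)) (allFunctions n k)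

iterate : ∀ {A : Set} → (A → A) → ℕ → A → A
iterate f zero x = x
iterate f (suc n) x = f (iterate f n x)

select3 : ∀ {A : Set} → A → A → A → Fin 3 → A
select3 a b c zero = a
select3 a b c (suc zero) = b
select3 a b c (suc (suc zero)) = c

applyWord : ∀ {A : Set} {n} → (Fin n → A → A) → List (Fin n) → A → A
applyWord f [] x = x
applyWord f (i ∷ is) x = applyWord f is (f i x)

-- white face w  ↦  black face across edge g of w  ↦  white face across
-- edge h of that black face
rotate : ∀ {m} → Permutation′ m → Permutation′ m → Fin m → Fin m
rotate g h w = h ⟨$⟩ˡ (g ⟨$⟩ʳ w)

-- Combinatorial encoding of a triangulation of the sphere whose faces
-- are properly 2-coloured (white/black) and whose vertices are properly
-- 3-coloured (R, C, S).
--
-- White faces and black faces are both indexed by Fin m (every edge lies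
-- in exactly one white and one black face, so there are equally many).
-- Vertices of colour R, C, S are Fin k, Fin nC, Fin nS.  White face w has
-- vertices wR w, wC w, wS w; black face b has vertices bR b, bC b, bS b.
-- glueRC w is the black face on the other side of the RC-edge of the
-- white face w (similarly glueRS, glueCS); these are bijections since
-- every edge lies in exactly one white and one black face.

record ColouredSphereTriangulation : Set where
  field
    m k nC nS : ℕ
    wR bR : Fin m → Fin k
    wC bC : Fin m → Fin nC
    wS bS : Fin m → Fin nS
    glueRC glueRS glueCS : Permutation′ m
    glueRC-R : ∀ w → bR (glueRC ⟨$⟩ʳ w) ≡ wR w
    glueRC-C : ∀ w → bC (glueRC ⟨$⟩ʳ w) ≡ wC w
    glueRS-R : ∀ w → bR (glueRS ⟨$⟩ʳ w) ≡ wR w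
    glueRS-S : ∀ w → bS (glueRS ⟨$⟩ʳ w) ≡ wS w
    glueCS-C : ∀ w → bC (glueCS ⟨$⟩ʳ w) ≡ wC w
    glueCS-S : ∀ w → bS (glueCS ⟨$⟩ʳ w) ≡ wS w

    -- rotations of the white faces around an R-, C-, S-vertex:
    --   rotR = rotate glueRC glueRS,  rotC = rotate glueRC glueCS,
    --   rotS = rotate glueRS glueCS
    -- every vertex lies on some face
    R-used : ∀ (v : Fin k) → ∃ λ w → wR w ≡ v
    C-used : ∀ (v : Fin nC) → ∃ λ w → wC w ≡ v
    S-used : ∀ (v : Fin nS) → ∃ λ w → wS w ≡ v
    -- the faces around each vertex form a single cycle (surface condition)
    R-link : ∀ w w′ → wR w ≡ wR w′ → ∃ λ n → iterate (rotate glueRC glueRS) n w ≡ w′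
    C-link : ∀ w w′ → wC w ≡ wC w′ → ∃ λ n → iterate (rotate glueRC glueCS) n w ≡ w′
    S-link : ∀ w w′ → wS w ≡ wS w′ → ∃ λ n → iterate (rotate glueRS glueCS) n w ≡ w′
    -- the surface is connected
    -- (any white face can be reached from any other by crossing edges;
    -- moving white → black → white is one of the rotations)
    connected : ∀ w w′ → ∃ λ (word : List (Fin 3)) →
                  applyWord (select3 (rotate glueRC glueRS) (rotate glueRC glueCS) (rotate glueRS glueCS)) word w ≡ w′
    -- Euler characteristic 2:  V - E + F = (k + nC + nS) - 3m + 2m = 2
    euler : k ℕ.+ nC ℕ.+ nS ≡ m ℕ.+ 2

module _ (𝒢 : ColouredSphereTriangulation) where
  open ColouredSphereTriangulation 𝒢

  -- number of C–S edges whose black triangle has vertex r_i and whose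
  -- white triangle has vertex r_j.  C–S edges correspond bijectively to
  -- white faces w (the C–S side of w); its black triangle is glueCS w.
  edgeCount : Fin k → Fin k → ℕ
  edgeCount i j = countFin (λ w → ⌊ wR w ≟ j ⌋ ∧ ⌊ bR (glueCS ⟨$⟩ʳ w) ≟ i ⌋)

  offDiag : Fin k → Fin k → ℕ
  offDiag i j = if ⌊ i ≟ j ⌋ then 0 else edgeCount i j

  T : Fin k → Fin k → ℤ
  T i j = if ⌊ i ≟ j ⌋ then - ℤ.+ (sumℕ (offDiag i)) else ℤ.+ (edgeCount i j)

  -- D has exactly t_ij = offDiag i j edges from z_j to z_i (i ≠ j).
  -- A spanning arborescence diverging from z is determined by choosing,
  -- for every vertex v ≠ z, the edge of D entering v (from its parent
  -- p v); the choice gives an arborescence iff following parents from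
  -- every vertex leads to z.  Encoding the parent map by p with p z = z,
  -- the number of spanning arborescences with parent map p is
  -- Π_{v ≠ z} offDiag v (p v), and the tree number is the sum of these
  -- over all parent maps p : Fin k → Fin k with p z = z that lead every
  -- vertex to z (k iterations always suffice).
  isParentMap : Fin k → (Fin k → Fin k) → Bool
  isParentMap z p = ⌊ p z ≟ z ⌋ ∧ allTrue (λ v → ⌊ iterate p k v ≟ z ⌋)

  arbWeight : Fin k → (Fin k → Fin k) → ℕ
  arbWeight z p = prodℕ (λ v → if ⌊ v ≟ z ⌋ then 1 else offDiag v (p v))

  treeNumber : Fin k → ℕ
  treeNumber z = sumList (map (λ p → if isParentMap z p then arbWeight z p else 0) (allFunctions k k))

  augmentation : (Fin k → ℤ) → ℤ
  augmentation = sumℤ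

-- The abelian group with generators x_1..x_k and relations
-- Σ_j M_ij x_j = 0 (1 ≤ i ≤ r):  ℤ^k modulo the subgroup generated by the
-- rows of M.  An element Σ_j a_j x_j is represented by a : Fin k → ℤ.

private
  sumℤ-cong : ∀ {n} {f g : Fin n → ℤ} → (∀ i → f i ≡ g i) → sumℤ f ≡ sumℤ g
  sumℤ-cong {zero} eq = refl
  sumℤ-cong {suc n} eq = cong₂ _+_ (eq zero) (sumℤ-cong (eq ∘ suc))

  sumℤ-0 : ∀ {n} → sumℤ {n} (λ _ → 0ℤ) ≡ 0ℤ
  sumℤ-0 {zero} = refl
  sumℤ-0 {suc n} = cong (0ℤ +_) (sumℤ-0 {n})

  sumℤ-+ : ∀ {n} (f g : Fin n → ℤ) → sumℤ (λ i → f i + g i) ≡ sumℤ f + sumℤ g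
  sumℤ-+ {zero} f g = refl
  sumℤ-+ {suc n} f g = trans (cong (f zero + g zero +_) (sumℤ-+ (f ∘ suc) (g ∘ suc)))
                             (lem (f zero) (g zero) (sumℤ (f ∘ suc)) (sumℤ (g ∘ suc)))
    where
    lem : ∀ a b c d → a + b + (c + d) ≡ a + c + (b + d)
    lem = solve-∀

  sumℤ-neg : ∀ {n} (f : Fin n → ℤ) → sumℤ (λ i → - f i) ≡ - sumℤ f
  sumℤ-neg {zero} f = refl
  sumℤ-neg {suc n} f = trans (cong (- f zero +_) (sumℤ-neg (f ∘ suc))) (lem (f zero) (sumℤ (f ∘ suc)))
    where
    lem : ∀ a b → - a + - b ≡ - (a + b)
    lem = solve-∀

module Presentation {r k : ℕ} (M : Fin r → Fin k → ℤ) where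

  Elt : Set
  Elt = Fin k → ℤ

  lin : (Fin r → ℤ) → Fin k → ℤ
  lin c j = sumℤ (λ i → c i * M i j)

  _≈_ : Elt → Elt → Set
  a ≈ b = Σ (Fin r → ℤ) λ c → ∀ j → a j - b j ≡ lin c j

  _⊕_ : Elt → Elt → Elt
  (a ⊕ b) j = a j + b j

  ⊝_ : Elt → Elt
  (⊝ a) j = - a j

  𝟘 : Elt
  𝟘 j = 0ℤ

  private
    lin-0 : ∀ j → lin (λ _ → 0ℤ) j ≡ 0ℤ
    lin-0 j = trans (sumℤ-cong (λ i → ℤP.*-zeroˡ (M i j))) (sumℤ-0 {r})

    lin-+ : ∀ c d j → lin (λ i → c i + d i) j ≡ lin c j + lin d j
    lin-+ c d j = trans (sumℤ-cong (λ i → ℤP.*-distribʳ-+ (M i j) (c i) (d i)))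
                        (sumℤ-+ (λ i → c i * M i j) (λ i → d i * M i j))

    lin-neg : ∀ c j → lin (λ i → - c i) j ≡ - lin c j
    lin-neg c j = trans (sumℤ-cong (λ i → sym (ℤP.neg-distribˡ-* (c i) (M i j))))
                        (sumℤ-neg (λ i → c i * M i j))

    ≡⇒≈ : ∀ {a b} → (∀ j → a j ≡ b j) → a ≈ b
    ≡⇒≈ {a} {b} eq = (λ _ → 0ℤ) , λ j →
      trans (cong (_- b j) (eq j)) (trans (ℤP.+-inverseʳ (b j)) (sym (lin-0 j)))

    ≈-refl : ∀ {a} → a ≈ a
    ≈-refl {a} = ≡⇒≈ {a} {a} (λ _ → refl)

    ≈-sym : ∀ {a b} → a ≈ b → b ≈ a
    ≈-sym {a} {b} (c , p) = (λ i → - c i) , λ j →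
      trans (lem (a j) (b j)) (trans (cong -_ (p j)) (sym (lin-neg c j)))
      where
      lem : ∀ x y → y - x ≡ - (x - y)
      lem = solve-∀

    ≈-trans : ∀ {a b e} → a ≈ b → b ≈ e → a ≈ e
    ≈-trans {a} {b} {e} (c , p) (d , q) = (λ i → c i + d i) , λ j →
      trans (lem (a j) (b j) (e j)) (trans (cong₂ _+_ (p j) (q j)) (sym (lin-+ c d j)))
      where
      lem : ∀ x y z → x - z ≡ (x - y) + (y - z)
      lem = solve-∀

    ⊕-cong : ∀ {a a′ b b′} → a ≈ a′ → b ≈ b′ → (a ⊕ b) ≈ (a′ ⊕ b′)
    ⊕-cong {a} {a′} {b} {b′} (c , p) (d , q) = (λ i → c i + d i) , λ j →
      trans (lem (a j) (a′ j) (b j) (b′ j)) (trans (cong₂ _+_ (p j) (q j)) (sym (lin-+ c d j)))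
      where
      lem : ∀ x x′ y y′ → (x + y) - (x′ + y′) ≡ (x - x′) + (y - y′)
      lem = solve-∀

    ⊝-cong : ∀ {a b} → a ≈ b → (⊝ a) ≈ (⊝ b)
    ⊝-cong {a} {b} (c , p) = (λ i → - c i) , λ j →
      trans (lem (a j) (b j)) (trans (cong -_ (p j)) (sym (lin-neg c j)))
      where
      lem : ∀ x y → - x - - y ≡ - (x - y)
      lem = solve-∀

    isAbelianGroup : IsAbelianGroup _≈_ _⊕_ 𝟘 ⊝_
    isAbelianGroup = record
      { isGroup = record
        { isMonoid = record
          { isSemigroup = record
            { isMagma = record
              { isEquivalence = record { refl = λ {a} → ≈-refl {a} ; sym = λ {a} {b} → ≈-sym {a} {b} ; trans = λ {a} {b} {e} → ≈-trans {a} {b} {e} }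
              ; ∙-cong = λ {a} {a′} {b} {b′} → ⊕-cong {a} {a′} {b} {b′}
              }
            ; assoc = λ a b e → ≡⇒≈ (λ j → ℤP.+-assoc (a j) (b j) (e j))
            }
          ; identity = (λ a → ≡⇒≈ (λ j → ℤP.+-identityˡ (a j)))
                     , (λ a → ≡⇒≈ (λ j → ℤP.+-identityʳ (a j)))
          }
        ; inverse = (λ a → ≡⇒≈ (λ j → ℤP.+-inverseˡ (a j)))
                  , (λ a → ≡⇒≈ (λ j → ℤP.+-inverseʳ (a j)))
        ; ⁻¹-cong = λ {a} {b} → ⊝-cong {a} {b}
        }
      ; comm = λ a b → ≡⇒≈ (λ j → ℤP.+-comm (a j) (b j))
      }

  presentedGroup : AbelianGroup 0ℓ 0ℓ
  presentedGroup = record { isAbelianGroup = isAbelianGroup }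

𝓑W : (𝒢 : ColouredSphereTriangulation) → AbelianGroup 0ℓ 0ℓ
𝓑W 𝒢 = Presentation.presentedGroup (T 𝒢)

{-# OPTIONS --safe #-}

-- Let N be -T with the row of the root z replaced by the unit vector at z.  As
-- T has vanishing row and column sums (D is Eulerian: black and white triangles
-- alternate around an R-vertex), x ↦ (Σ x, x) identifies 𝓑W with ℤ × coker N.
-- Integer row operations reduce N to triangular form, so coker N has |det N|
-- elements.  Row v ≠ z of N is a combination of vectors e_v - e_u, so det N
-- expands multilinearly over the parent maps p, and det (e_v - e_{p v})_v is 1 if
-- p leads every vertex to z and 0 otherwise: det N is the tree number.  It is
-- nonzero because connectedness of the sphere makes D strongly connected.
module Submission where

open import Defs
open import Level using (0ℓ)
open import Data.Bool.Base using (Bool; true; false; if_then_else_; _∧_)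
open import Data.Nat.Base as ℕ using (ℕ; zero; suc)
import Data.Nat.Properties as ℕP
open import Data.Nat.Induction using (<-wellFounded)
open import Data.Integer.Base as ℤ using (ℤ; _+_; _*_; -_; _-_; 0ℤ; 1ℤ; ∣_∣) renaming (+_ to pos)
open import Data.Integer.Properties using (+-0-abelianGroup)
import Data.Integer.Properties as ℤP
import Data.Integer.DivMod as DivMod
open import Data.Integer.Tactic.RingSolver using (solve-∀)
open import Data.Fin.Base using (Fin; zero; suc; punchIn; toℕ; fromℕ<; combine)
open import Data.Fin.Properties using (_≟_; any?; pigeonhole; toℕ<n; fromℕ<-toℕ; fromℕ<-cong; fromℕ<-injective; combine-injective; combine-surjective)
open import Data.Fin.Permutation using (Permutation′; _⟨$⟩ʳ_; inverseʳ)
open import Data.List.Base using (List; []; _∷_; _++_; map; concatMap; allFin; tabulate)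
open import Data.List.Relation.Unary.Any as Any using (Any; here; there)
import Data.List.Relation.Unary.Any.Properties as AnyP
open import Data.Maybe.Base using (Maybe; just; nothing)
open import Data.Product.Base using (Σ-syntax; ∃; _×_; _,_; proj₁; proj₂)
open import Data.Sum.Base using (_⊎_; inj₁; inj₂)
open import Data.Empty using (⊥-elim)
open import Function.Base using (_∘_; id)
open import Function.Bundles using (Bijection)
open import Induction.WellFounded using (Acc; acc)
open import Relation.Nullary using (Dec; yes; no; ¬_; contradiction)
open import Relation.Nullary.Decidable using (⌊_⌋; _×-dec_; _⊎-dec_; ¬?)
open import Relation.Binary.PropositionalEquality
open import Algebra.Bundles using (AbelianGroup)
open import Algebra.Morphism.Structures using (module GroupMorphisms)
open import Algebra.Construct.DirectProduct using (abelianGroup)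
import Algebra.Properties.Group (AbelianGroup.group +-0-abelianGroup) as ℤG
import Algebra.Properties.Semiring.Sum ℤP.+-*-semiring as ℤΣ

open Presentation using (lin) renaming (_≈_ to _⊢_≈_)
open ≡-Reasoning

-- The order of the finite summand is to be a bijection with `Fin d`, so its elements have to be
-- classified explicitly. Row operations suit this: they preserve the subgroup of relations itself,
-- with no change of coordinates. They need only preserve the determinant up to sign, since the
-- expansion over parent maps settles the sign. Row z is replaced, not deleted together with column
-- z, so that the choices in the expansion are functions `Fin k → Fin k`, the index set of
-- `treeNumber`. Zero column sums make row z of `T` redundant; zero row sums make the augmentation
-- well defined. As the first component of the isomorphism is the augmentation, coker N is
-- identified with its kernel. The laborious point is that `det`, defined by expansion along one
-- row, changes sign when two rows are exchanged.

sumℤ≡sum : ∀ {n} (f : Fin n → ℤ) → sumℤ f ≡ ℤΣ.sum f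
sumℤ≡sum {zero}  f = refl
sumℤ≡sum {suc n} f = cong (f zero +_) (sumℤ≡sum (f ∘ suc))

sumℤ-cong : ∀ {n} {f g : Fin n → ℤ} → (∀ i → f i ≡ g i) → sumℤ f ≡ sumℤ g
sumℤ-cong {zero}  f≗g = refl
sumℤ-cong {suc n} f≗g = cong₂ _+_ (f≗g zero) (sumℤ-cong (f≗g ∘ suc))

sumℤ-+ : ∀ {n} (f g : Fin n → ℤ) → sumℤ (λ i → f i + g i) ≡ sumℤ f + sumℤ g
sumℤ-+ f g = trans (sumℤ≡sum (λ i → f i + g i)) (trans (ℤΣ.∑-distrib-+ f g)
  (cong₂ _+_ (sym (sumℤ≡sum f)) (sym (sumℤ≡sum g))))

*-distribˡ-sumℤ : ∀ {n} a (f : Fin n → ℤ) → a * sumℤ f ≡ sumℤ (λ i → a * f i)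
*-distribˡ-sumℤ a f = trans (cong (a *_) (sumℤ≡sum f))
  (trans (ℤΣ.*-distribˡ-sum a f) (sym (sumℤ≡sum (λ i → a * f i))))

*-distribʳ-sumℤ : ∀ {n} a (f : Fin n → ℤ) → sumℤ f * a ≡ sumℤ (λ i → f i * a)
*-distribʳ-sumℤ a f = trans (cong (_* a) (sumℤ≡sum f))
  (trans (ℤΣ.*-distribʳ-sum a f) (sym (sumℤ≡sum (λ i → f i * a))))

sumℤ-comm : ∀ {m n} (f : Fin m → Fin n → ℤ) →
            sumℤ (λ i → sumℤ (f i)) ≡ sumℤ (λ j → sumℤ (λ i → f i j))
sumℤ-comm f = begin
  sumℤ (λ i → sumℤ (f i))                ≡⟨ sumℤ-cong (λ i → sumℤ≡sum (f i)) ⟩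
  sumℤ (λ i → ℤΣ.sum (f i))              ≡⟨ sumℤ≡sum (λ i → ℤΣ.sum (f i)) ⟩
  ℤΣ.sum (λ i → ℤΣ.sum (f i))            ≡⟨ ℤΣ.∑-comm f ⟩
  ℤΣ.sum (λ j → ℤΣ.sum (λ i → f i j))    ≡⟨ sumℤ≡sum (λ j → ℤΣ.sum (λ i → f i j)) ⟨
  sumℤ (λ j → ℤΣ.sum (λ i → f i j))      ≡⟨ sumℤ-cong (λ j → sumℤ≡sum (λ i → f i j)) ⟨
  sumℤ (λ j → sumℤ (λ i → f i j))        ∎

sumℤ-zero : ∀ {n} (f : Fin n → ℤ) → (∀ i → f i ≡ 0ℤ) → sumℤ f ≡ 0ℤ
sumℤ-zero {zero}  f f≗0 = refl
sumℤ-zero {suc n} f f≗0 = cong₂ _+_ (f≗0 zero) (sumℤ-zero (f ∘ suc) (f≗0 ∘ suc))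

sumℤ-neg : ∀ {n} (f : Fin n → ℤ) → sumℤ (λ i → - f i) ≡ - sumℤ f
sumℤ-neg f = begin
  sumℤ (λ i → - f i)       ≡⟨ sumℤ-cong (λ i → ℤP.-1*i≡-i (f i)) ⟨
  sumℤ (λ i → ℤ.-1ℤ * f i) ≡⟨ *-distribˡ-sumℤ ℤ.-1ℤ f ⟨
  ℤ.-1ℤ * sumℤ f           ≡⟨ ℤP.-1*i≡-i (sumℤ f) ⟩
  - sumℤ f                 ∎

sumℤ-difference : ∀ {n} (x y : Fin n → ℤ) → sumℤ (λ j → x j - y j) ≡ sumℤ x - sumℤ y
sumℤ-difference x y = trans (sumℤ-+ x (λ j → - y j)) (cong (sumℤ x +_) (sumℤ-neg y))

sumℤ-permute : ∀ {n} (π : Permutation′ n) (f : Fin n → ℤ) → sumℤ (λ i → f (π ⟨$⟩ʳ i)) ≡ sumℤ f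
sumℤ-permute π f = trans (sumℤ≡sum (λ i → f (π ⟨$⟩ʳ i))) (trans (sym (ℤΣ.sum-permute f π)) (sym (sumℤ≡sum f)))

-- Recursive in both indices, so that in minors and contracted graphs `δ (suc i) (suc j)` reduces to
-- `δ i j`.
δ : ∀ {n} → Fin n → Fin n → ℤ
δ zero    zero    = 1ℤ
δ zero    (suc j) = 0ℤ
δ (suc i) zero    = 0ℤ
δ (suc i) (suc j) = δ i j

δ-refl : ∀ {n} (i : Fin n) → δ i i ≡ 1ℤ
δ-refl zero    = refl
δ-refl (suc i) = δ-refl i

δ-≢ : ∀ {n} {i j : Fin n} → i ≢ j → δ i j ≡ 0ℤ
δ-≢ {i = zero}  {zero}  i≢j = contradiction refl i≢j
δ-≢ {i = zero}  {suc j} i≢j = refl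
δ-≢ {i = suc i} {zero}  i≢j = refl
δ-≢ {i = suc i} {suc j} i≢j = δ-≢ (i≢j ∘ cong suc)

sumℤ-δ : ∀ {n} (i : Fin n) (f : Fin n → ℤ) → sumℤ (λ j → δ i j * f j) ≡ f i
sumℤ-δ zero f = begin
  1ℤ * f zero + sumℤ (λ j → 0ℤ * f (suc j))
    ≡⟨ cong (1ℤ * f zero +_) (sumℤ-zero (λ j → 0ℤ * f (suc j)) (λ j → refl)) ⟩
  1ℤ * f zero + 0ℤ                          ≡⟨ ℤP.+-identityʳ (1ℤ * f zero) ⟩
  1ℤ * f zero                               ≡⟨ ℤP.*-identityˡ (f zero) ⟩
  f zero                                    ∎
sumℤ-δ (suc i) f = trans (ℤP.+-identityˡ (sumℤ (λ j → δ i j * f (suc j)))) (sumℤ-δ i (f ∘ suc))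

δ-sym : ∀ {n} (i j : Fin n) → δ i j ≡ δ j i
δ-sym zero    zero    = refl
δ-sym zero    (suc j) = refl
δ-sym (suc i) zero    = refl
δ-sym (suc i) (suc j) = δ-sym i j

sumℤ-δʳ : ∀ {n} (j : Fin n) (f : Fin n → ℤ) → sumℤ (λ i → δ i j * f i) ≡ f j
sumℤ-δʳ j f = trans (sumℤ-cong (λ i → cong (_* f i) (δ-sym i j))) (sumℤ-δ j f)

-- Determinants and row operations

Matrix : ℕ → ℕ → Set
Matrix m n = Fin m → Fin n → ℤ

sgn : ∀ {n} → Fin n → ℤ
sgn zero    = 1ℤ
sgn (suc i) = - sgn i

minor : ∀ {m n} → Matrix (suc m) (suc n) → Fin (suc n) → Matrix m n
minor M j i l = M (suc i) (punchIn j l)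

det : ∀ {n} → Matrix n n → ℤ
det {zero}  M = 1ℤ
det {suc n} M = sumℤ λ j → sgn j * (M zero j * det (minor M j))

det-cong : ∀ {n} {M N : Matrix n n} → (∀ i j → M i j ≡ N i j) → det M ≡ det N
det-cong {zero}          M≗N = refl
det-cong {suc n} {M} {N} M≗N = sumℤ-cong λ j → cong (sgn j *_)
  (cong₂ _*_ (M≗N zero j) (det-cong {M = minor M j} {minor N j} (λ i l → M≗N (suc i) (punchIn j l))))

det-zeroRow : ∀ {n} (M : Matrix (suc n) (suc n)) → (∀ j → M zero j ≡ 0ℤ) → det M ≡ 0ℤ
det-zeroRow M M₀≗0 = sumℤ-zero (λ j → sgn j * (M zero j * det (minor M j))) λ j →
  trans (cong (λ x → sgn j * (x * det (minor M j))) (M₀≗0 j)) (ℤP.*-zeroʳ (sgn j))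

-- A minor that omits another column still has column 0 in first place, so it vanishes by induction;
-- the minor that omits column 0 is multiplied by a zero entry.
det-zeroColumn : ∀ {n} (M : Matrix (suc n) (suc n)) → (∀ i → M i zero ≡ 0ℤ) → det M ≡ 0ℤ
det-zeroColumn {n} M M⁰≗0 = sumℤ-zero (λ j → sgn j * (M zero j * det (minor M j))) λ j →
  trans (cong (sgn j *_) (term n M M⁰≗0 j)) (ℤP.*-zeroʳ (sgn j))
  where
  term : ∀ n (M : Matrix (suc n) (suc n)) → (∀ i → M i zero ≡ 0ℤ) → ∀ j →
         M zero j * det (minor M j) ≡ 0ℤ
  term n       M M⁰≗0 zero    = cong (_* det (minor M zero)) (M⁰≗0 zero)
  term (suc n) M M⁰≗0 (suc j) =
    trans (cong (M zero (suc j) *_) (det-zeroColumn (minor M (suc j)) (M⁰≗0 ∘ suc)))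
          (ℤP.*-zeroʳ (M zero (suc j)))

det-block : ∀ {n} (M : Matrix (suc n) (suc n)) → (∀ i → M (suc i) zero ≡ 0ℤ) →
            det M ≡ M zero zero * det (minor M zero)
det-block {n} M M⁰≗0 = begin
  1ℤ * p + sumℤ (rest M)  ≡⟨ cong₂ _+_ (ℤP.*-identityˡ p) (sumℤ-zero (rest M) (rest≡0 M M⁰≗0)) ⟩
  p + 0ℤ                  ≡⟨ ℤP.+-identityʳ p ⟩
  p                       ∎
  where
  p = M zero zero * det (minor M zero)
  rest : ∀ {n} → Matrix (suc n) (suc n) → Fin n → ℤ
  rest M j = - sgn j * (M zero (suc j) * det (minor M (suc j)))
  rest≡0 : ∀ {n} (M : Matrix (suc n) (suc n)) → (∀ i → M (suc i) zero ≡ 0ℤ) → ∀ j → rest M j ≡ 0ℤ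
  rest≡0 {suc n} M q j = begin
    - sgn j * (M zero (suc j) * det (minor M (suc j)))
      ≡⟨ cong (λ x → - sgn j * (M zero (suc j) * x)) (det-zeroColumn (minor M (suc j)) q) ⟩
    - sgn j * (M zero (suc j) * 0ℤ)
      ≡⟨ cong (- sgn j *_) (ℤP.*-zeroʳ (M zero (suc j))) ⟩
    - sgn j * 0ℤ
      ≡⟨ ℤP.*-zeroʳ (- sgn j) ⟩
    0ℤ ∎

-- The expansion of a determinant along its first two rows A and B; D is the
-- complementary minor as a function of the embedding of the remaining columns.
module _ {n} (D : (Fin n → Fin (2 ℕ.+ n)) → ℤ) where

  term₂ : (Fin (2 ℕ.+ n) → ℤ) → Fin (2 ℕ.+ n) → Fin (suc n) → ℤ
  term₂ B j l = sgn l * (B (punchIn j l) * D (λ c → punchIn j (punchIn l c)))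

  expand₂ : (A B : Fin (2 ℕ.+ n) → ℤ) → ℤ
  expand₂ A B = sumℤ λ j → sgn j * (A j * sumℤ (term₂ B j))

  border : (Fin (2 ℕ.+ n) → ℤ) → ℤ
  border A = sumℤ λ j → sgn j * (A (suc j) * D (λ c → suc (punchIn j c)))

  coreTerm : (Fin (2 ℕ.+ n) → ℤ) → Fin (suc n) → Fin n → ℤ
  coreTerm B j l = sgn l * (B (suc (punchIn j l)) * D (λ c → punchIn (suc j) (punchIn (suc l) c)))

  core : (A B : Fin (2 ℕ.+ n) → ℤ) → ℤ
  core A B = sumℤ λ j → sgn j * (A (suc j) * sumℤ (coreTerm B j))

  -- Pairs of columns containing column 0 make up the antisymmetric border; the
  -- others form an expansion with column 0 removed.
  expand₂-border : ∀ A B → expand₂ A B ≡ A zero * border B - B zero * border A + core A B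
  expand₂-border A B = begin
    expand₂ A B
      ≡⟨⟩
    1ℤ * (A zero * border B) + sumℤ row
      ≡⟨ cong (1ℤ * (A zero * border B) +_) (sumℤ-cong row-split) ⟩
    1ℤ * (A zero * border B) + sumℤ (λ j → - B zero * borderTerm j + coreRow j)
      ≡⟨ cong (1ℤ * (A zero * border B) +_) (sumℤ-+ (λ j → - B zero * borderTerm j) coreRow) ⟩
    1ℤ * (A zero * border B) + (sumℤ (λ j → - B zero * borderTerm j) + core A B)
      ≡⟨ cong (λ x → 1ℤ * (A zero * border B) + (x + core A B)) (*-distribˡ-sumℤ (- B zero) borderTerm) ⟨
    1ℤ * (A zero * border B) + (- B zero * border A + core A B)
      ≡⟨ collect (A zero) (border B) (B zero) (border A) (core A B) ⟩
    A zero * border B - B zero * border A + core A B ∎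
    where
    row borderTerm coreRow : Fin (suc n) → ℤ
    row j = sgn (suc j) * (A (suc j) * sumℤ (term₂ B (suc j)))
    borderTerm j = sgn j * (A (suc j) * D (λ c → suc (punchIn j c)))
    coreRow j = sgn j * (A (suc j) * sumℤ (coreTerm B j))
    rearrange : ∀ s a b e h → - s * (a * (1ℤ * (b * e) + - h)) ≡ - b * (s * (a * e)) + s * (a * h)
    rearrange = solve-∀
    collect : ∀ a x b y r → 1ℤ * (a * x) + (- b * y + r) ≡ a * x - b * y + r
    collect = solve-∀
    negate : ∀ j → sumℤ (λ l → term₂ B (suc j) (suc l)) ≡ - sumℤ (coreTerm B j)
    negate j = trans
      (sumℤ-cong (λ l → sym (ℤP.neg-distribˡ-* (sgn l)
        (B (suc (punchIn j l)) * D (λ c → punchIn (suc j) (punchIn (suc l) c))))))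
      (sumℤ-neg (coreTerm B j))
    row-split : ∀ j → row j ≡ - B zero * borderTerm j + coreRow j
    row-split j = trans
      (cong (λ x → - sgn j * (A (suc j) * (1ℤ * (B zero * D (λ c → suc (punchIn j c))) + x))) (negate j))
      (rearrange (sgn j) (A (suc j)) (B zero) (D (λ c → suc (punchIn j c))) (sumℤ (coreTerm B j)))

lift : ∀ {m n} → (Fin m → Fin n) → Fin (suc m) → Fin (suc n)
lift f zero    = zero
lift f (suc i) = suc (f i)

-- Stands in for function extensionality: the column embeddings compared below agree only pointwise.
Extensional : ∀ {m n} → ((Fin m → Fin n) → ℤ) → Set
Extensional D = ∀ f g → (∀ i → f i ≡ g i) → D f ≡ D g

-- Column 0 survives, in first place, in every complementary minor of `core`, so `lift` absorbs it
-- into `D`.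
core≡expand₂ : ∀ {n} (D : (Fin (suc n) → Fin (3 ℕ.+ n)) → ℤ) → Extensional D → ∀ A B →
               core D A B ≡ expand₂ (D ∘ lift) (A ∘ suc) (B ∘ suc)
core≡expand₂ D D-ext A B = sumℤ-cong λ j → cong (λ x → sgn j * (A (suc j) * x))
  (sumℤ-cong λ l → cong (λ x → sgn l * (B (suc (punchIn j l)) * x))
    (D-ext (λ c → punchIn (suc j) (punchIn (suc l) c)) (lift (λ c → punchIn j (punchIn l c)))
      λ { zero → refl ; (suc c) → refl }))

-- The border visibly changes sign when `A` and `B` are exchanged, and the core is an expansion with
-- one column fewer; hence the mutual induction.
expand₂-antisym : ∀ {n} (D : (Fin n → Fin (2 ℕ.+ n)) → ℤ) → Extensional D → ∀ A B →
                  expand₂ D A B ≡ - expand₂ D B A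
core-antisym : ∀ {n} (D : (Fin n → Fin (2 ℕ.+ n)) → ℤ) → Extensional D → ∀ A B →
               core D A B ≡ - core D B A

expand₂-antisym D D-ext A B = begin
  expand₂ D A B
    ≡⟨ expand₂-border D A B ⟩
  A zero * border D B - B zero * border D A + core D A B
    ≡⟨ cong (A zero * border D B - B zero * border D A +_) (core-antisym D D-ext A B) ⟩
  A zero * border D B - B zero * border D A - core D B A
    ≡⟨ flip (A zero * border D B) (B zero * border D A) (core D B A) ⟩
  - (B zero * border D A - A zero * border D B + core D B A)
    ≡⟨ cong -_ (expand₂-border D B A) ⟨
  - expand₂ D B A ∎
  where
  flip : ∀ x y r → x - y - r ≡ - (y - x + r)
  flip = solve-∀

-- With two columns in all, no pair avoids column 0: the inner sum is empty.
core-antisym {zero} D D-ext A B = vanish (A (suc zero)) (B (suc zero))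
  where
  vanish : ∀ a b → 1ℤ * (a * 0ℤ) + 0ℤ ≡ - (1ℤ * (b * 0ℤ) + 0ℤ)
  vanish = solve-∀
core-antisym {suc n} D D-ext A B = begin
  core D A B                                  ≡⟨ core≡expand₂ D D-ext A B ⟩
  expand₂ (D ∘ lift) (A ∘ suc) (B ∘ suc)      ≡⟨ expand₂-antisym (D ∘ lift) lift-ext (A ∘ suc) (B ∘ suc) ⟩
  - expand₂ (D ∘ lift) (B ∘ suc) (A ∘ suc)    ≡⟨ cong -_ (core≡expand₂ D D-ext B A) ⟨
  - core D B A                                ∎
  where
  lift-ext : Extensional (D ∘ lift)
  lift-ext f g f≗g = D-ext (lift f) (lift g) λ { zero → refl ; (suc c) → cong suc (f≗g c) }

x≡-x⇒x≡0 : ∀ x → x ≡ - x → x ≡ 0ℤ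
x≡-x⇒x≡0 (pos zero) _ = refl

-- An operation under row 0 acts alike on all minors of the first-row expansion,
-- so only the operations on rows 0 and 1 need a second expansion.
data RowOp : ℕ → Set where
  swap  : ∀ {n} → RowOp (2 ℕ.+ n)
  add   : ∀ {n} → ℤ → RowOp (2 ℕ.+ n)
  under : ∀ {n} → RowOp n → RowOp (suc n)

-- Acting on single columns lets a sequence of operations be chosen by inspecting one column and
-- then applied to the whole matrix.
actColumn : ∀ {n} → RowOp n → (Fin n → ℤ) → Fin n → ℤ
actColumn swap      v zero          = v (suc zero)
actColumn swap      v (suc zero)    = v zero
actColumn swap      v (suc (suc i)) = v (suc (suc i))
actColumn (add a)   v zero          = v zero
actColumn (add a)   v (suc zero)    = v (suc zero) + a * v zero
actColumn (add a)   v (suc (suc i)) = v (suc (suc i))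
actColumn (under o) v zero          = v zero
actColumn (under o) v (suc i)       = actColumn o (v ∘ suc) i

act : ∀ {m n} → RowOp m → Matrix m n → Matrix m n
act o M i j = actColumn o (λ r → M r j) i

opSign : ∀ {n} → RowOp n → ℤ
opSign swap      = - 1ℤ
opSign (add a)   = 1ℤ
opSign (under o) = opSign o

inverse : ∀ {n} → RowOp n → RowOp n
inverse swap      = swap
inverse (add a)   = add (- a)
inverse (under o) = under (inverse o)

-- Linearity in the second row leaves `a` times an expansion with two equal rows, which by
-- antisymmetry is its own negative and so zero.
expand₂-addMultiple : ∀ {n} (D : (Fin n → Fin (2 ℕ.+ n)) → ℤ) → Extensional D → ∀ a A B →
                      expand₂ D A (λ j → B j + a * A j) ≡ expand₂ D A B
expand₂-addMultiple D D-ext a A B = begin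
  expand₂ D A (λ j → B j + a * A j)
    ≡⟨ sumℤ-cong (λ j → trans (cong (λ x → sgn j * (A j * x)) (inner j))
                              (outer (sgn j) (A j) (sumℤ (term₂ D B j)) a (sumℤ (term₂ D A j)))) ⟩
  sumℤ (λ j → row B j + a * row A j)
    ≡⟨ sumℤ-+ (row B) (λ j → a * row A j) ⟩
  expand₂ D A B + sumℤ (λ j → a * row A j)
    ≡⟨ cong (expand₂ D A B +_) (*-distribˡ-sumℤ a (row A)) ⟨
  expand₂ D A B + a * expand₂ D A A
    ≡⟨ cong (λ x → expand₂ D A B + a * x) (x≡-x⇒x≡0 (expand₂ D A A) (expand₂-antisym D D-ext A A)) ⟩
  expand₂ D A B + a * 0ℤ
    ≡⟨ cong (expand₂ D A B +_) (ℤP.*-zeroʳ a) ⟩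
  expand₂ D A B + 0ℤ
    ≡⟨ ℤP.+-identityʳ (expand₂ D A B) ⟩
  expand₂ D A B ∎
  where
  row : _ → _ → ℤ
  row C j = sgn j * (A j * sumℤ (term₂ D C j))
  distribute : ∀ s b a x d → s * ((b + a * x) * d) ≡ s * (b * d) + a * (s * (x * d))
  distribute = solve-∀
  outer : ∀ s x i a k → s * (x * (i + a * k)) ≡ s * (x * i) + a * (s * (x * k))
  outer = solve-∀
  inner : ∀ j → sumℤ (term₂ D (λ j → B j + a * A j) j) ≡ sumℤ (term₂ D B j) + a * sumℤ (term₂ D A j)
  inner j = begin
    sumℤ (term₂ D (λ j → B j + a * A j) j)
      ≡⟨ sumℤ-cong (λ l → distribute (sgn l) (B (punchIn j l)) a (A (punchIn j l)) (D (λ c → punchIn j (punchIn l c)))) ⟩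
    sumℤ (λ l → term₂ D B j l + a * term₂ D A j l)
      ≡⟨ sumℤ-+ (term₂ D B j) (λ l → a * term₂ D A j l) ⟩
    sumℤ (term₂ D B j) + sumℤ (λ l → a * term₂ D A j l)
      ≡⟨ cong (sumℤ (term₂ D B j) +_) (*-distribˡ-sumℤ a (term₂ D A j)) ⟨
    sumℤ (term₂ D B j) + a * sumℤ (term₂ D A j) ∎

minor₂ : ∀ {n} → Matrix (2 ℕ.+ n) (2 ℕ.+ n) → (Fin n → Fin (2 ℕ.+ n)) → ℤ
minor₂ M f = det (λ i c → M (suc (suc i)) (f c))

minor₂-ext : ∀ {n} (M : Matrix (2 ℕ.+ n) (2 ℕ.+ n)) → Extensional (minor₂ M)
minor₂-ext M f g f≗g = det-cong {M = λ i c → M (suc (suc i)) (f c)} λ i c → cong (M (suc (suc i))) (f≗g c)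

-- Two unfoldings of `det M` give `expand₂ (minor₂ M) (M zero) (M (suc zero))` definitionally, so
-- the two-row results apply directly.
det-act : ∀ {n} (o : RowOp n) (M : Matrix n n) → det (act o M) ≡ opSign o * det M
det-act swap M = trans (expand₂-antisym (minor₂ M) (minor₂-ext M) (M (suc zero)) (M zero))
                       (sym (ℤP.-1*i≡-i (det M)))
det-act (add a) M = trans (expand₂-addMultiple (minor₂ M) (minor₂-ext M) a (M zero) (M (suc zero)))
                          (sym (ℤP.*-identityˡ (det M)))
det-act (under o) M = begin
  sumℤ (λ j → sgn j * (M zero j * det (act o (minor M j))))
    ≡⟨ sumℤ-cong (λ j → trans (cong (λ x → sgn j * (M zero j * x)) (det-act o (minor M j)))
                              (pull (sgn j) (M zero j) (opSign o) (det (minor M j)))) ⟩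
  sumℤ (λ j → opSign o * (sgn j * (M zero j * det (minor M j))))
    ≡⟨ *-distribˡ-sumℤ (opSign o) (λ j → sgn j * (M zero j * det (minor M j))) ⟨
  opSign o * det M ∎
  where
  pull : ∀ s a o d → s * (a * (o * d)) ≡ o * (s * (a * d))
  pull = solve-∀

∣opSign∣≡1 : ∀ {n} (o : RowOp n) → ∣ opSign o ∣ ≡ 1
∣opSign∣≡1 swap      = refl
∣opSign∣≡1 (add a)   = refl
∣opSign∣≡1 (under o) = ∣opSign∣≡1 o

∣det-act∣ : ∀ {n} (o : RowOp n) (M : Matrix n n) → ∣ det (act o M) ∣ ≡ ∣ det M ∣
∣det-act∣ o M = begin
  ∣ det (act o M) ∣            ≡⟨ cong ∣_∣ (det-act o M) ⟩
  ∣ opSign o * det M ∣         ≡⟨ ℤP.abs-* (opSign o) (det M) ⟩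
  ∣ opSign o ∣ ℕ.* ∣ det M ∣   ≡⟨ cong (ℕ._* ∣ det M ∣) (∣opSign∣≡1 o) ⟩
  1 ℕ.* ∣ det M ∣              ≡⟨ ℕP.*-identityˡ ∣ det M ∣ ⟩
  ∣ det M ∣                    ∎

actColumn-inverse : ∀ {n} (o : RowOp n) v i → actColumn (inverse o) (actColumn o v) i ≡ v i
actColumn-inverse swap      v zero          = refl
actColumn-inverse swap      v (suc zero)    = refl
actColumn-inverse swap      v (suc (suc i)) = refl
actColumn-inverse (add a)   v zero          = refl
actColumn-inverse (add a)   v (suc zero)    = cancel (v (suc zero)) a (v zero)
  where
  cancel : ∀ x a y → x + a * y + - a * y ≡ x
  cancel = solve-∀
actColumn-inverse (add a)   v (suc (suc i)) = refl
actColumn-inverse (under o) v zero          = refl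
actColumn-inverse (under o) v (suc i)       = actColumn-inverse o (v ∘ suc) i

-- Row combinations and integer elimination in a column

dot : ∀ {n} → (Fin n → ℤ) → (Fin n → ℤ) → ℤ
dot c v = sumℤ λ i → c i * v i

sumℤ-lin : ∀ {m n} (M : Matrix m n) c → sumℤ (lin M c) ≡ dot c (λ i → sumℤ (M i))
sumℤ-lin M c = trans (sumℤ-comm (λ j i → c i * M i j)) (sumℤ-cong (λ i → sym (*-distribˡ-sumℤ (c i) (M i))))

-- The transposed operation on coefficients. As `c′` does not depend on `v`, one choice serves all
-- columns: row combinations after the operation are row combinations before it.
actColumn-adjoint : ∀ {n} (o : RowOp n) (c : Fin n → ℤ) →
                    Σ[ c′ ∈ (Fin n → ℤ) ] (∀ v → dot c (actColumn o v) ≡ dot c′ v)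
actColumn-adjoint swap c = actColumn swap c , λ v →
  exchange (c zero * v (suc zero)) (c (suc zero) * v zero) _
  where
  exchange : ∀ x y z → x + (y + z) ≡ y + (x + z)
  exchange = solve-∀
actColumn-adjoint (add a) c =
  (λ { zero → c zero + c (suc zero) * a ; (suc i) → c (suc i) }) ,
  λ v → regroup (c zero) (v zero) (c (suc zero)) (v (suc zero)) a _
  where
  regroup : ∀ c₀ v₀ c₁ v₁ a r →
            c₀ * v₀ + (c₁ * (v₁ + a * v₀) + r) ≡ (c₀ + c₁ * a) * v₀ + (c₁ * v₁ + r)
  regroup = solve-∀
actColumn-adjoint (under o) c with actColumn-adjoint o (c ∘ suc)
... | c′ , eq = (λ { zero → c zero ; (suc i) → c′ i }) , λ v → cong (c zero * v zero +_) (eq (v ∘ suc))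

actColumns : ∀ {n} → List (RowOp n) → (Fin n → ℤ) → Fin n → ℤ
actColumns []       v = v
actColumns (o ∷ os) v = actColumns os (actColumn o v)

actColumns-++ : ∀ {n} (os ps : List (RowOp n)) v i →
                actColumns (os ++ ps) v i ≡ actColumns ps (actColumns os v) i
actColumns-++ []       ps v i = refl
actColumns-++ (o ∷ os) ps v i = actColumns-++ os ps (actColumn o v) i

actColumns-under : ∀ {n} (os : List (RowOp n)) v i →
                   actColumns (map under os) v (suc i) ≡ actColumns os (v ∘ suc) i
actColumns-under []       v i = refl
actColumns-under (o ∷ os) v i = actColumns-under os (actColumn (under o) v) i

-- Euclid's algorithm on the first two entries: a swap and the subtraction of a multiple put the
-- remainder into place 1, whose absolute value decreases. Entries further down stay fixed, which
-- protects zeros already produced there.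
euclid : ∀ {n} (v : Fin (2 ℕ.+ n) → ℤ) → Acc ℕ._<_ ∣ v (suc zero) ∣ →
         Σ[ os ∈ List (RowOp (2 ℕ.+ n)) ]
           actColumns os v (suc zero) ≡ 0ℤ × (∀ i → actColumns os v (suc (suc i)) ≡ v (suc (suc i)))
euclid v (acc rec) with v (suc zero) ℤP.≟ 0ℤ
... | yes v₁≡0 = [] , v₁≡0 , λ i → refl
... | no  v₁≢0 =
  let os , cleared , fixed = euclid v′ (rec smaller)
  in swap ∷ add (- (v zero ℤ./ v (suc zero))) ∷ os , cleared , fixed
  where
  instance
    nonZero : ℕ.NonZero ∣ v (suc zero) ∣
    nonZero = ℕ.≢-nonZero (v₁≢0 ∘ ℤP.∣i∣≡0⇒i≡0)
  q = v zero ℤ./ v (suc zero)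
  v′ = actColumn (add (- q)) (actColumn swap v)
  cancel : ∀ r q b → r + q * b + - q * b ≡ r
  cancel = solve-∀
  remainder : v′ (suc zero) ≡ pos (v zero ℤ.% v (suc zero))
  remainder = trans (cong (_+ - q * v (suc zero)) (DivMod.a≡a%n+[a/n]*n (v zero) (v (suc zero))))
                    (cancel _ q (v (suc zero)))
  smaller : ∣ v′ (suc zero) ∣ ℕ.< ∣ v (suc zero) ∣
  smaller = subst (ℕ._< ∣ v (suc zero) ∣) (cong ∣_∣ (sym remainder)) (DivMod.n%d<d (v zero) (v (suc zero)))

-- The tail is first cleared below its own top entry; Euclid's algorithm on rows 0 and 1 then
-- removes that entry.
clearColumn : ∀ {n} (v : Fin (suc n) → ℤ) →
              Σ[ os ∈ List (RowOp (suc n)) ] (∀ i → actColumns os v (suc i) ≡ 0ℤ)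
clearColumn {zero}  v = [] , λ ()
clearColumn {suc n} v = map under os ++ ps , λ
  { zero    → trans (actColumns-++ (map under os) ps v (suc zero)) cleared₁
  ; (suc i) → begin
      actColumns (map under os ++ ps) v (suc (suc i)) ≡⟨ actColumns-++ (map under os) ps v _ ⟩
      actColumns ps v′ (suc (suc i))                  ≡⟨ fixed i ⟩
      v′ (suc (suc i))                                ≡⟨ actColumns-under os v (suc i) ⟩
      actColumns os (v ∘ suc) (suc i)                 ≡⟨ cleared i ⟩
      0ℤ                                              ∎ }
  where
  tail = clearColumn (v ∘ suc)
  os = proj₁ tail
  cleared = proj₂ tail
  v′ = actColumns (map under os) v
  two = euclid v′ (<-wellFounded _)
  ps = proj₁ two
  cleared₁ = proj₁ (proj₂ two)
  fixed = proj₂ (proj₂ two)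

≈-act : ∀ {m n} (o : RowOp m) (M : Matrix m n) {x y} → act o M ⊢ x ≈ y → M ⊢ x ≈ y
≈-act o M (c , eq) with actColumn-adjoint o c
... | c′ , adj = c′ , λ j → trans (eq j) (adj (λ r → M r j))

≈-unact : ∀ {m n} (o : RowOp m) (M : Matrix m n) {x y} → M ⊢ x ≈ y → act o M ⊢ x ≈ y
≈-unact o M (c , eq) with actColumn-adjoint (inverse o) c
... | c′ , adj = c′ , λ j → begin
  _                                                                  ≡⟨ eq j ⟩
  dot c (λ r → M r j)                                                ≡⟨ sumℤ-cong (λ i → cong (c i *_) (actColumn-inverse o (λ r → M r j) i)) ⟨
  dot c (actColumn (inverse o) (actColumn o (λ r → M r j)))          ≡⟨ adj (actColumn o (λ r → M r j)) ⟩
  dot c′ (actColumn o (λ r → M r j))                                 ∎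

-- The order of the cokernel

-- The fibres of `index` are exactly the cosets of the row module, so surjectivity turns it into a
-- bijection of the quotient with `Fin d`.
record Cokernel {n} (M : Matrix n n) (d : ℕ) : Set where
  field
    index      : (Fin n → ℤ) → Fin d
    index-cong : ∀ x y → M ⊢ x ≈ y → index x ≡ index y
    index-inj  : ∀ x y → index x ≡ index y → M ⊢ x ≈ y
    index-surj : ∀ i → Σ[ x ∈ (Fin n → ℤ) ] index x ≡ i

open Cokernel

-- The row module is the same subgroup before and after the operation, so `index` is reused
-- verbatim.
Cokernel-unact : ∀ {n d} (o : RowOp n) (M : Matrix n n) → Cokernel (act o M) d → Cokernel M d
Cokernel-unact o M C = record
  { index      = index C
  ; index-cong = λ x y → index-cong C x y ∘ ≈-unact o M {x} {y}
  ; index-inj  = λ x y → ≈-act o M {x} {y} ∘ index-inj C x y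
  ; index-surj = index-surj C
  }

-- Subtracting the two representations gives |q - q′| |d| = |r′ - r| ≤ max(r, r′) < |d|.
divMod-unique : ∀ {d} r r′ q q′ → r ℕ.< ∣ d ∣ → r′ ℕ.< ∣ d ∣ → pos r + q * d ≡ pos r′ + q′ * d → q ≡ q′
divMod-unique {d} r r′ q q′ r<d r′<d eq = ℤP.i-j≡0⇒i≡j q q′ (ℤP.∣i∣≡0⇒i≡0
  (ℕP.n<1⇒n≡0 (ℕP.*-cancelʳ-< ∣ d ∣ ∣ q - q′ ∣ 1 bound)))
  where
  difference : ∀ r r′ q q′ d → r + q * d ≡ r′ + q′ * d → (q - q′) * d ≡ r′ - r
  difference r r′ q q′ d eq = begin
    (q - q′) * d                           ≡⟨ lemma r r′ q q′ d ⟩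
    r + q * d - (r′ + q′ * d) + (r′ - r)   ≡⟨ cong (_+ (r′ - r)) (ℤP.i≡j⇒i-j≡0 eq) ⟩
    0ℤ + (r′ - r)                          ≡⟨ ℤP.+-identityˡ (r′ - r) ⟩
    r′ - r                                 ∎
    where
    lemma : ∀ r r′ q q′ d → (q - q′) * d ≡ r + q * d - (r′ + q′ * d) + (r′ - r)
    lemma = solve-∀
  bound : ∣ q - q′ ∣ ℕ.* ∣ d ∣ ℕ.< 1 ℕ.* ∣ d ∣
  bound = subst₂ ℕ._<_
    (sym (trans (sym (ℤP.abs-* (q - q′) d))
                (cong ∣_∣ (trans (difference (pos r) (pos r′) q q′ d eq) (ℤP.m-n≡m⊖n r′ r)))))
    (sym (ℕP.*-identityˡ ∣ d ∣))
    (ℕP.≤-<-trans (ℤP.∣m⊝n∣≤m⊔n r′ r) (ℕP.⊔-pres-<m r′<d r<d))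

-- Row 0 reduces the first coordinate to its residue modulo the pivot. The other coordinates,
-- corrected by the same multiple of row 0, then matter only modulo the minor, because the lower
-- rows vanish in column 0.
Cokernel-block : ∀ {n e} (M : Matrix (suc n) (suc n)) → (∀ i → M (suc i) zero ≡ 0ℤ) →
                 ℕ.NonZero ∣ M zero zero ∣ → Cokernel (minor M zero) e →
                 Cokernel M (∣ M zero zero ∣ ℕ.* e)
Cokernel-block {n} {e} M M⁰≗0 nonZero C = record
  { index      = λ x → combine (residue x) (index C (reduce x))
  ; index-cong = well-defined
  ; index-inj  = inj
  ; index-surj = surj
  }
  where
  instance _ = nonZero
  d = M zero zero
  quot : (Fin (suc n) → ℤ) → ℤ
  quot x = x zero ℤ./ d
  rem : (Fin (suc n) → ℤ) → ℕ
  rem x = x zero ℤ.% d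
  residue : (Fin (suc n) → ℤ) → Fin ∣ d ∣
  residue x = fromℕ< (DivMod.n%d<d (x zero) d)
  reduce : (Fin (suc n) → ℤ) → Fin n → ℤ
  reduce x j = x (suc j) - quot x * M zero (suc j)
  divMod : ∀ x → x zero ≡ pos (rem x) + quot x * d
  divMod x = DivMod.a≡a%n+[a/n]*n (x zero) d

  lin-zero : ∀ c → lin M c zero ≡ c zero * d
  lin-zero c = trans
    (cong (c zero * d +_) (sumℤ-zero (λ i → c (suc i) * M (suc i) zero) λ i →
      trans (cong (c (suc i) *_) (M⁰≗0 i)) (ℤP.*-zeroʳ (c (suc i)))))
    (ℤP.+-identityʳ (c zero * d))

  well-defined : ∀ x y → M ⊢ x ≈ y → combine (residue x) (index C (reduce x)) ≡ combine (residue y) (index C (reduce y))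
  well-defined x y (c , eq) = cong₂ (combine {∣ d ∣} {e}) (fromℕ<-cong _ _ rem≡ _ _)
    (index-cong C (reduce x) (reduce y) (c ∘ suc , λ j → begin
      reduce x j - reduce y j
        ≡⟨ cong (λ q → x (suc j) - q * M zero (suc j) - reduce y j) quot≡ ⟩
      x (suc j) - (c zero + quot y) * M zero (suc j) - reduce y j
        ≡⟨ regroup (x (suc j)) (y (suc j)) (c zero) (quot y) (M zero (suc j)) ⟩
      x (suc j) - y (suc j) - c zero * M zero (suc j)
        ≡⟨ cong (_- c zero * M zero (suc j)) (eq (suc j)) ⟩
      c zero * M zero (suc j) + lin (minor M zero) (c ∘ suc) j - c zero * M zero (suc j)
        ≡⟨ cancel (c zero * M zero (suc j)) _ ⟩
      lin (minor M zero) (c ∘ suc) j ∎))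
    where
    regroup : ∀ a b c q m → a - (c + q) * m - (b - q * m) ≡ a - b - c * m
    regroup = solve-∀
    cancel : ∀ a b → a + b - a ≡ b
    cancel = solve-∀
    shift : ∀ a b → a ≡ a - b + b
    shift = solve-∀
    assemble : ∀ c r q d → c * d + (r + q * d) ≡ r + (c + q) * d
    assemble = solve-∀
    x₀≡ : pos (rem x) + quot x * d ≡ pos (rem y) + (c zero + quot y) * d
    x₀≡ = begin
      pos (rem x) + quot x * d                 ≡⟨ divMod x ⟨
      x zero                               ≡⟨ shift (x zero) (y zero) ⟩
      x zero - y zero + y zero             ≡⟨ cong₂ _+_ (trans (eq zero) (lin-zero c)) (divMod y) ⟩
      c zero * d + (pos (rem y) + quot y * d)  ≡⟨ assemble (c zero) (pos (rem y)) (quot y) d ⟩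
      pos (rem y) + (c zero + quot y) * d      ∎
    quot≡ : quot x ≡ c zero + quot y
    quot≡ = divMod-unique (rem x) (rem y) (quot x) (c zero + quot y)
      (DivMod.n%d<d (x zero) d) (DivMod.n%d<d (y zero) d) x₀≡
    rem≡ : rem x ≡ rem y
    rem≡ = ℤP.+-injective (ℤG.∙-cancelʳ (quot x * d) (pos (rem x)) (pos (rem y))
      (trans x₀≡ (cong (λ q → pos (rem y) + q * d) (sym quot≡))))

  inj : ∀ x y → combine (residue x) (index C (reduce x)) ≡ combine (residue y) (index C (reduce y)) → M ⊢ x ≈ y
  inj x y eq with combine-injective (residue x) _ (residue y) _ eq
  ... | residue≡ , index≡ with index-inj C (reduce x) (reduce y) index≡
  ... | c , reduce≡ = c′ , λ
    { zero → begin
        x zero - y zero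
          ≡⟨ cong₂ _-_ (trans (divMod x) (cong (λ r → pos r + quot x * d) rem≡)) (divMod y) ⟩
        pos (rem y) + quot x * d - (pos (rem y) + quot y * d)
          ≡⟨ factor (pos (rem y)) (quot x) (quot y) d ⟩
        (quot x - quot y) * d
          ≡⟨ lin-zero c′ ⟨
        lin M c′ zero ∎
    ; (suc j) → begin
        x (suc j) - y (suc j)
          ≡⟨ split (x (suc j)) (y (suc j)) (quot x) (quot y) (M zero (suc j)) ⟩
        (quot x - quot y) * M zero (suc j) + (reduce x j - reduce y j)
          ≡⟨ cong ((quot x - quot y) * M zero (suc j) +_) (reduce≡ j) ⟩
        lin M c′ (suc j) ∎ }
    where
    -- Row 0 has to account for the difference of the quotients; the other coefficients come from
    -- the minor.
    c′ : Fin (suc n) → ℤ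
    c′ zero    = quot x - quot y
    c′ (suc i) = c i
    rem≡ : rem x ≡ rem y
    rem≡ = fromℕ<-injective _ _ _ _ residue≡
    factor : ∀ r p q d → r + p * d - (r + q * d) ≡ (p - q) * d
    factor = solve-∀
    split : ∀ a b p q m → a - b ≡ (p - q) * m + (a - p * m - (b - q * m))
    split = solve-∀

  surj : ∀ i → Σ[ x ∈ (Fin (suc n) → ℤ) ] combine (residue x) (index C (reduce x)) ≡ i
  surj i with combine-surjective {∣ d ∣} {e} i
  ... | r , k , refl with index-surj C k
  ... | x′ , refl = x , cong₂ (combine {∣ d ∣} {e})
    (trans (fromℕ<-cong _ _ rem≡ _ (toℕ<n r)) (fromℕ<-toℕ r (toℕ<n r)))
    (index-cong C (reduce x) x′ ((λ _ → 0ℤ) , λ j → begin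
      x′ j - quot x * M zero (suc j) - x′ j ≡⟨ cong (λ q → x′ j - q * M zero (suc j) - x′ j) quot≡ ⟩
      x′ j - 0ℤ * M zero (suc j) - x′ j     ≡⟨ vanish (x′ j) (M zero (suc j)) ⟩
      0ℤ                                    ≡⟨ sumℤ-zero (λ i → 0ℤ * M (suc i) (suc j)) (λ i → ℤP.*-zeroˡ (M (suc i) (suc j))) ⟨
      lin (minor M zero) (λ _ → 0ℤ) j ∎))
    where
    -- A first coordinate that is already a residue has quotient 0, so `reduce` returns the tail
    -- unchanged.
    x : Fin (suc n) → ℤ
    x zero    = pos (toℕ r)
    x (suc j) = x′ j
    x₀≡ : pos (rem x) + quot x * d ≡ pos (toℕ r) + 0ℤ * d
    x₀≡ = trans (sym (divMod x)) (sym (ℤP.+-identityʳ (pos (toℕ r))))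
    quot≡ : quot x ≡ 0ℤ
    quot≡ = divMod-unique (rem x) (toℕ r) (quot x) 0ℤ (DivMod.n%d<d (x zero) d) (toℕ<n r) x₀≡
    rem≡ : rem x ≡ toℕ r
    rem≡ = ℤP.+-injective (ℤG.∙-cancelʳ (quot x * d) (pos (rem x)) (pos (toℕ r))
      (trans x₀≡ (cong (λ q → pos (toℕ r) + q * d) (sym quot≡))))
    vanish : ∀ a m → a - 0ℤ * m - a ≡ 0ℤ
    vanish = solve-∀

acts : ∀ {m n} → List (RowOp m) → Matrix m n → Matrix m n
acts []       M = M
acts (o ∷ os) M = acts os (act o M)

acts≡actColumns : ∀ {m n} (os : List (RowOp m)) (M : Matrix m n) i j →
                  acts os M i j ≡ actColumns os (λ r → M r j) i
acts≡actColumns []       M i j = refl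
acts≡actColumns (o ∷ os) M i j = acts≡actColumns os (act o M) i j

∣det-acts∣ : ∀ {n} (os : List (RowOp n)) (M : Matrix n n) → ∣ det (acts os M) ∣ ≡ ∣ det M ∣
∣det-acts∣ []       M = refl
∣det-acts∣ (o ∷ os) M = trans (∣det-acts∣ os (act o M)) (∣det-act∣ o M)

Cokernel-unacts : ∀ {n d} (os : List (RowOp n)) (M : Matrix n n) → Cokernel (acts os M) d → Cokernel M d
Cokernel-unacts []       M C = C
Cokernel-unacts (o ∷ os) M C = Cokernel-unact o M (Cokernel-unacts os (act o M) C)

-- After elimination the determinant is, up to sign, the pivot times the determinant of the minor.
-- Its being nonzero therefore permits division by the pivot and passes on to the minor.
cokernel-suc : ∀ {n} → (∀ (M : Matrix n n) → ℕ.NonZero ∣ det M ∣ → Cokernel M ∣ det M ∣) →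
               ∀ (M : Matrix (suc n) (suc n)) → ℕ.NonZero ∣ det M ∣ → Cokernel M ∣ det M ∣
cokernel-suc {n} coker M nonZero = subst (Cokernel M) (sym ∣det∣)
  (Cokernel-unacts os M (Cokernel-block N N⁰≗0 (ℕP.m*n≢0⇒m≢0 ∣ N zero zero ∣ {{product≢0}})
    (coker (minor N zero) (ℕP.m*n≢0⇒n≢0 ∣ N zero zero ∣ {{product≢0}}))))
  where
  os = proj₁ (clearColumn (λ r → M r zero))
  N = acts os M
  N⁰≗0 : ∀ i → N (suc i) zero ≡ 0ℤ
  N⁰≗0 i = trans (acts≡actColumns os M (suc i) zero) (proj₂ (clearColumn (λ r → M r zero)) i)
  ∣det∣ : ∣ det M ∣ ≡ ∣ N zero zero ∣ ℕ.* ∣ det (minor N zero) ∣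
  ∣det∣ = trans (sym (∣det-acts∣ os M))
    (trans (cong ∣_∣ (det-block N N⁰≗0)) (ℤP.abs-* (N zero zero) (det (minor N zero))))
  product≢0 : ℕ.NonZero (∣ N zero zero ∣ ℕ.* ∣ det (minor N zero) ∣)
  product≢0 = subst ℕ.NonZero ∣det∣ nonZero

cokernel : ∀ {n} (M : Matrix n n) → ℕ.NonZero ∣ det M ∣ → Cokernel M ∣ det M ∣
cokernel {zero}  M _       = record
  { index      = λ _ → zero
  ; index-cong = λ _ _ _ → refl
  ; index-inj  = λ _ _ _ → (λ ()) , λ ()
  ; index-surj = λ { zero → (λ ()) , refl }
  }
cokernel {suc n} = cokernel-suc cokernel

-- Determinants of functional graphs

sumOver : ∀ {A : Set} → List A → (A → ℤ) → ℤ
sumOver []       f = 0ℤ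
sumOver (x ∷ xs) f = f x + sumOver xs f

sumOver-cong : ∀ {A : Set} (xs : List A) {f g : A → ℤ} → (∀ x → f x ≡ g x) → sumOver xs f ≡ sumOver xs g
sumOver-cong []       f≗g = refl
sumOver-cong (x ∷ xs) f≗g = cong₂ _+_ (f≗g x) (sumOver-cong xs f≗g)

sumOver-++ : ∀ {A : Set} (xs ys : List A) f → sumOver (xs ++ ys) f ≡ sumOver xs f + sumOver ys f
sumOver-++ []       ys f = sym (ℤP.+-identityˡ (sumOver ys f))
sumOver-++ (x ∷ xs) ys f = trans (cong (f x +_) (sumOver-++ xs ys f))
                                 (sym (ℤP.+-assoc (f x) (sumOver xs f) (sumOver ys f)))

sumOver-concatMap : ∀ {A B : Set} (g : A → List B) xs f →
                    sumOver (concatMap g xs) f ≡ sumOver xs (λ x → sumOver (g x) f)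
sumOver-concatMap g []       f = refl
sumOver-concatMap g (x ∷ xs) f = trans (sumOver-++ (g x) (concatMap g xs) f)
                                       (cong (sumOver (g x) f +_) (sumOver-concatMap g xs f))

sumOver-map : ∀ {A B : Set} (g : A → B) xs f → sumOver (map g xs) f ≡ sumOver xs (f ∘ g)
sumOver-map g []       f = refl
sumOver-map g (x ∷ xs) f = cong (f (g x) +_) (sumOver-map g xs f)

sumOver-tabulate : ∀ {A : Set} {n} (g : Fin n → A) f → sumOver (tabulate g) f ≡ sumℤ (f ∘ g)
sumOver-tabulate {n = zero}  g f = refl
sumOver-tabulate {n = suc n} g f = cong (f (g zero) +_) (sumOver-tabulate (g ∘ suc) f)

*-distribˡ-sumOver : ∀ {A : Set} a (xs : List A) f → a * sumOver xs f ≡ sumOver xs (λ x → a * f x)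
*-distribˡ-sumOver a []       f = ℤP.*-zeroʳ a
*-distribˡ-sumOver a (x ∷ xs) f = trans (ℤP.*-distribˡ-+ a (f x) (sumOver xs f))
                                        (cong (a * f x +_) (*-distribˡ-sumOver a xs f))

sumℤ-sumOver : ∀ {A : Set} {n} (xs : List A) (f : Fin n → A → ℤ) →
               sumℤ (λ j → sumOver xs (f j)) ≡ sumOver xs (λ x → sumℤ (λ j → f j x))
sumℤ-sumOver {n = n} [] f = sumℤ-zero {n} (λ j → 0ℤ) (λ _ → refl)
sumℤ-sumOver (x ∷ xs) f = trans (sumℤ-+ (λ j → f j x) (λ j → sumOver xs (f j)))
                                (cong (sumℤ (λ j → f j x) +_) (sumℤ-sumOver xs f))

sumOver-allFunctions-suc : ∀ n k (f : (Fin (suc n) → Fin k) → ℤ) →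
  sumOver (allFunctions (suc n) k) f ≡ sumOver (allFunctions n k) (λ g → sumℤ (λ x → f (consFun x g)))
sumOver-allFunctions-suc n k f = trans
  (sumOver-concatMap (λ g → map (λ x → consFun x g) (allFin k)) (allFunctions n k) f)
  (sumOver-cong (allFunctions n k) λ g →
    trans (sumOver-map (λ x → consFun x g) (allFin k) f) (sumOver-tabulate id (λ x → f (consFun x g))))

prodℤ : ∀ {n} → (Fin n → ℤ) → ℤ
prodℤ {zero}  f = 1ℤ
prodℤ {suc n} f = f zero * prodℤ (f ∘ suc)

combination : ∀ {m n k} → (Fin m → Fin k → ℤ) → (Fin m → Fin k → Fin n → ℤ) → Matrix m n
combination c r i j = sumℤ λ l → c i l * r i l j

-- Picking one summand in each row is picking a function; the choice in row 0 is prepended by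
-- `consFun`, following the recursion of `allFunctions`.
det-multilinear : ∀ n {k} (c : Fin n → Fin k → ℤ) (r : Fin n → Fin k → Fin n → ℤ) →
  det (combination c r) ≡ sumOver (allFunctions n k) (λ f → prodℤ (λ i → c i (f i)) * det (λ i → r i (f i)))
det-multilinear zero    c r = refl
det-multilinear (suc n) {k} c r = begin
  sumℤ (λ j → sgn j * (combination c r zero j * det (minor (combination c r) j)))
    ≡⟨ sumℤ-cong expandTerm ⟩
  sumℤ (λ j → sumOver fs (λ f → sumℤ (λ x → term j f x)))
    ≡⟨ sumℤ-sumOver fs (λ j f → sumℤ (λ x → term j f x)) ⟩
  sumOver fs (λ f → sumℤ (λ j → sumℤ (λ x → term j f x)))
    ≡⟨ sumOver-cong fs (λ f → sumℤ-comm (λ j x → term j f x)) ⟩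
  sumOver fs (λ f → sumℤ (λ x → sumℤ (λ j → term j f x)))
    ≡⟨ sumOver-cong fs (λ f → sumℤ-cong λ x → sym (*-distribˡ-sumℤ (c zero x * P f) (λ j → sgn j * (r zero x j * m j f)))) ⟩
  sumOver fs (λ f → sumℤ (λ x → F (consFun x f)))
    ≡⟨ sumOver-allFunctions-suc n k F ⟨
  sumOver (allFunctions (suc n) k) F ∎
  where
  fs = allFunctions n k
  F : (Fin (suc n) → Fin k) → ℤ
  F f = prodℤ (λ i → c i (f i)) * det (λ i → r i (f i))
  P : (Fin n → Fin k) → ℤ
  P f = prodℤ (λ i → c (suc i) (f i))
  m : Fin (suc n) → (Fin n → Fin k) → ℤ
  m j f = det (λ i l → r (suc i) (f i) (punchIn j l))
  term : Fin (suc n) → (Fin n → Fin k) → Fin k → ℤ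
  term j f x = (c zero x * P f) * (sgn j * (r zero x j * m j f))
  rearrange : ∀ s c r p m → s * (c * r * (p * m)) ≡ c * p * (s * (r * m))
  rearrange = solve-∀
  expandTerm : ∀ j → sgn j * (combination c r zero j * det (minor (combination c r) j)) ≡
                     sumOver fs (λ f → sumℤ (λ x → term j f x))
  expandTerm j = begin
    sgn j * (combination c r zero j * det (minor (combination c r) j))
      ≡⟨ cong (λ x → sgn j * (combination c r zero j * x))
           (det-multilinear n (c ∘ suc) (λ i x l → r (suc i) x (punchIn j l))) ⟩
    sgn j * (combination c r zero j * sumOver fs (λ f → P f * m j f))
      ≡⟨ cong (sgn j *_) (*-distribˡ-sumOver (combination c r zero j) fs (λ f → P f * m j f)) ⟩
    sgn j * sumOver fs (λ f → combination c r zero j * (P f * m j f))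
      ≡⟨ *-distribˡ-sumOver (sgn j) fs (λ f → combination c r zero j * (P f * m j f)) ⟩
    sumOver fs (λ f → sgn j * (combination c r zero j * (P f * m j f)))
      ≡⟨ sumOver-cong fs (λ f → begin
           sgn j * (combination c r zero j * (P f * m j f))
             ≡⟨ cong (sgn j *_) (*-distribʳ-sumℤ (P f * m j f) (λ x → c zero x * r zero x j)) ⟩
           sgn j * sumℤ (λ x → c zero x * r zero x j * (P f * m j f))
             ≡⟨ *-distribˡ-sumℤ (sgn j) (λ x → c zero x * r zero x j * (P f * m j f)) ⟩
           sumℤ (λ x → sgn j * (c zero x * r zero x j * (P f * m j f)))
             ≡⟨ sumℤ-cong (λ x → rearrange (sgn j) (c zero x) (r zero x j) (P f) (m j f)) ⟩
           sumℤ (λ x → term j f x) ∎) ⟩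
    sumOver fs (λ f → sumℤ (λ x → term j f x)) ∎

sweep : ∀ {m n} → (Fin m → ℤ) → Matrix (suc m) n → Matrix (suc m) n
sweep c M zero    j = M zero j
sweep c M (suc i) j = M (suc i) j + c i * M zero j

-- `add` affects only the row just below. Row 0 is therefore added to row 1, swapped with it, and
-- swept through the remaining rows inside the minors along the new first row; a second swap
-- restores the order and cancels the sign.
det-sweep : ∀ {n} (c : Fin n → ℤ) (M : Matrix (suc n) (suc n)) → det (sweep c M) ≡ det M
det-sweep {zero}  c M = det-cong {M = sweep c M} {M} λ { zero j → refl }
det-sweep {suc n} c M = begin
  det (sweep c M)               ≡⟨ det-cong {M = sweep c M} {act swap P} sweep≗ ⟩
  det (act swap P)              ≡⟨ det-act swap P ⟩
  - 1ℤ * det P                  ≡⟨ cong (- 1ℤ *_) det-P ⟩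
  - 1ℤ * det Q                  ≡⟨ cong (- 1ℤ *_) (det-act swap (act (add (c zero)) M)) ⟩
  - 1ℤ * (- 1ℤ * det (act (add (c zero)) M))
                                ≡⟨ cong (λ x → - 1ℤ * (- 1ℤ * x)) (det-act (add (c zero)) M) ⟩
  - 1ℤ * (- 1ℤ * (1ℤ * det M))  ≡⟨ cancel (det M) ⟩
  det M                         ∎
  where
  Q P : Matrix (2 ℕ.+ n) (2 ℕ.+ n)
  Q = act swap (act (add (c zero)) M)
  P zero    = Q zero
  P (suc i) = sweep (c ∘ suc) (Q ∘ suc) i
  sweep≗ : ∀ i j → sweep c M i j ≡ act swap P i j
  sweep≗ zero          j = refl
  sweep≗ (suc zero)    j = refl
  sweep≗ (suc (suc i)) j = refl
  det-P : det P ≡ det Q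
  det-P = sumℤ-cong λ j → cong (λ x → sgn j * (Q zero j * x)) (trans
    (det-cong {M = minor P j} {sweep (c ∘ suc) (minor Q j)} λ { zero l → refl ; (suc i) l → refl })
    (det-sweep (c ∘ suc) (minor Q j)))
  cancel : ∀ x → - 1ℤ * (- 1ℤ * (1ℤ * x)) ≡ x
  cancel = solve-∀

-- Functional graphs and elimination of a vertex

PartialMap : ℕ → Set
PartialMap n = Fin n → Maybe (Fin n)

target : ∀ {n} → Maybe (Fin n) → Fin n → ℤ
target nothing  j = 0ℤ
target (just i) j = δ i j

-- Identity minus the adjacency matrix of the functional graph; a vertex without a target has a unit
-- row.
graphMatrix : ∀ {n} → PartialMap n → Matrix n n
graphMatrix q i j = δ i j - target (q i) j

data Terminates {n} (q : PartialMap n) : Fin n → Set where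
  halt : ∀ {i} → q i ≡ nothing → Terminates q i
  step : ∀ {i j} → q i ≡ just j → Terminates q j → Terminates q i

lower : ∀ {n} → Maybe (Fin (suc n)) → Maybe (Fin n)
lower nothing        = nothing
-- A default: a loop at 0 is excluded wherever this value matters.
lower (just zero)    = nothing
lower (just (suc i)) = just i

bypass : ∀ {n} → Maybe (Fin n) → Maybe (Fin (suc n)) → Maybe (Fin n)
bypass q₀ nothing        = nothing
bypass q₀ (just zero)    = q₀
bypass q₀ (just (suc i)) = just i

-- Vertex 0 is removed by redirecting the arcs into it to its own target
-- (meaningful only if 0 is not a fixed point).
contract : ∀ {n} → PartialMap (suc n) → PartialMap n
contract q i = bypass (lower (q zero)) (q (suc i))

target-zero : ∀ {n} (x : Maybe (Fin (suc n))) → x ≢ just zero → target x zero ≡ 0ℤ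
target-zero nothing        x≢0 = refl
target-zero (just zero)    x≢0 = contradiction refl x≢0
target-zero (just (suc i)) x≢0 = refl

target-lower : ∀ {n} (x : Maybe (Fin (suc n))) j → target x (suc j) ≡ target (lower x) j
target-lower nothing        j = refl
target-lower (just zero)    j = refl
target-lower (just (suc i)) j = refl

-- Adding row 0 to the row e_i - e_0 of a vertex that points to 0 replaces e_0 by the target of 0,
-- which is the redirection made by `contract`. Without a loop at 0 the pivot is 1, so the
-- elimination costs no factor.
det-contract : ∀ {n} (q : PartialMap (suc n)) → q zero ≢ just zero →
               det (graphMatrix q) ≡ det (graphMatrix (contract q))
det-contract {n} q q₀≢0 = begin
  det (graphMatrix q)                          ≡⟨ det-sweep c (graphMatrix q) ⟨
  det S                                        ≡⟨ det-block S cleared ⟩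
  S zero zero * det (minor S zero)             ≡⟨ cong (λ t → (1ℤ - t) * det (minor S zero)) (target-zero (q zero) q₀≢0) ⟩
  1ℤ * det (minor S zero)                      ≡⟨ ℤP.*-identityˡ (det (minor S zero)) ⟩
  det (minor S zero)                           ≡⟨ det-cong {M = minor S zero} {graphMatrix (contract q)} contracted ⟩
  det (graphMatrix (contract q))               ∎
  where
  c : Fin n → ℤ
  c i = target (q (suc i)) zero
  S = sweep c (graphMatrix q)
  cancel : ∀ t → 0ℤ - t + t * (1ℤ - 0ℤ) ≡ 0ℤ
  cancel = solve-∀
  cleared : ∀ i → S (suc i) zero ≡ 0ℤ
  cleared i = trans (cong (λ t → 0ℤ - c i + c i * (1ℤ - t)) (target-zero (q zero) q₀≢0)) (cancel (c i))
  contracted : ∀ i j → minor S zero i j ≡ graphMatrix (contract q) i j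
  contracted i j with q (suc i)
  ... | nothing      = drop (δ i j) 0ℤ (target (q zero) (suc j))
    where
    drop : ∀ a b t → a - b + 0ℤ * (0ℤ - t) ≡ a - b
    drop = solve-∀
  ... | just (suc l) = drop (δ i j) (δ l j) (target (q zero) (suc j))
    where
    drop : ∀ a b t → a - b + 0ℤ * (0ℤ - t) ≡ a - b
    drop = solve-∀
  ... | just zero    = trans (merge (δ i j) (target (q zero) (suc j)))
                             (cong (λ t → δ i j - t) (target-lower (q zero) j))
    where
    merge : ∀ a t → a - 0ℤ + 1ℤ * (0ℤ - t) ≡ a - t
    merge = solve-∀

module _ {n} (q : PartialMap (suc n)) where

  ¬Terminates-loop : q zero ≡ just zero → ¬ Terminates q zero
  ¬Terminates-loop loop (halt q₀≡) with () ← trans (sym loop) q₀≡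
  ¬Terminates-loop loop (step q₀≡ t) with refl ← trans (sym loop) q₀≡ = ¬Terminates-loop loop t

  contract-Terminates : ∀ {i} → Terminates q (suc i) → Terminates (contract q) i
  contract-Terminates (halt q≡) = halt (cong (bypass (lower (q zero))) q≡)
  contract-Terminates (step {j = suc j} q≡ t) =
    step (cong (bypass (lower (q zero))) q≡) (contract-Terminates t)
  contract-Terminates (step {j = zero} q≡ (halt q₀≡)) =
    halt (trans (cong (bypass (lower (q zero))) q≡) (cong lower q₀≡))
  contract-Terminates (step {j = zero} q≡ (step {j = suc j} q₀≡ t)) =
    step (trans (cong (bypass (lower (q zero))) q≡) (cong lower q₀≡)) (contract-Terminates t)
  contract-Terminates (step {j = zero} q≡ (step {j = zero} q₀≡ t)) = ⊥-elim (¬Terminates-loop q₀≡ t)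

  module _ (q₀≢0 : q zero ≢ just zero) where

    contract-via-zero : ∀ {i y} → q (suc i) ≡ just zero → q zero ≡ y → contract q i ≡ lower y
    contract-via-zero q≡ q₀≡ = trans (cong (bypass (lower (q zero))) q≡) (cong lower q₀≡)

    -- `x` and `y` enter through equations so that they can be split without disturbing `contract q`
    -- in the type of the termination witness, on which the recursion runs.
    uncontract-suc : ∀ {i} → Terminates (contract q) i → ∀ {x y} → q (suc i) ≡ x → q zero ≡ y →
                     Terminates q (suc i)
    uncontract-suc t           {nothing}                  q≡ q₀≡ = halt q≡
    uncontract-suc (halt c≡)   {just (suc j)}             q≡ q₀≡
      with () ← trans (sym c≡) (cong (bypass (lower (q zero))) q≡)
    uncontract-suc (step c≡ t) {just (suc j)}             q≡ q₀≡
      with refl ← trans (sym c≡) (cong (bypass (lower (q zero))) q≡) = step q≡ (uncontract-suc t refl refl)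
    uncontract-suc t           {just zero} {nothing}      q≡ q₀≡ = step q≡ (halt q₀≡)
    uncontract-suc t           {just zero} {just zero}    q≡ q₀≡ = contradiction q₀≡ q₀≢0
    uncontract-suc (halt c≡)   {just zero} {just (suc j)} q≡ q₀≡
      with () ← trans (sym c≡) (contract-via-zero q≡ q₀≡)
    uncontract-suc (step c≡ t) {just zero} {just (suc j)} q≡ q₀≡
      with refl ← trans (sym c≡) (contract-via-zero q≡ q₀≡) = step q≡ (step q₀≡ (uncontract-suc t refl refl))

    uncontract-zero : (∀ i → Terminates (contract q) i) → ∀ {y} → q zero ≡ y → Terminates q zero
    uncontract-zero t {nothing}      q₀≡ = halt q₀≡
    uncontract-zero t {just zero}    q₀≡ = contradiction q₀≡ q₀≢0
    uncontract-zero t {just (suc j)} q₀≡ = step q₀≡ (uncontract-suc (t j) refl refl)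

    uncontract-Terminates : (∀ i → Terminates (contract q) i) → ∀ i → Terminates q i
    uncontract-Terminates t zero    = uncontract-zero t refl
    uncontract-Terminates t (suc i) = uncontract-suc (t i) refl refl

isLoop? : ∀ {n} (x : Maybe (Fin (suc n))) → Dec (x ≡ just zero)
isLoop? nothing        = no λ ()
isLoop? (just zero)    = yes refl
isLoop? (just (suc i)) = no λ ()

-- A loop at 0 gives a zero row and an orbit that never stops. Otherwise contracting 0 preserves
-- both the determinant and the termination of all orbits.
det-graphMatrix : ∀ {n} (q : PartialMap n) →
                  (det (graphMatrix q) ≡ 1ℤ × (∀ i → Terminates q i)) ⊎
                  (det (graphMatrix q) ≡ 0ℤ × ¬ (∀ i → Terminates q i))
det-graphMatrix {zero}  q = inj₁ (refl , λ ())
det-graphMatrix {suc n} q with isLoop? (q zero)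
... | yes q₀≡0 = inj₂
  ( det-zeroRow (graphMatrix q)
      (λ j → trans (cong (λ x → δ zero j - target x j) q₀≡0) (ℤP.+-inverseʳ (δ zero j)))
  , λ t → ¬Terminates-loop q q₀≡0 (t zero) )
... | no  q₀≢0 with det-graphMatrix (contract q)
...   | inj₁ (det≡1 , t)  = inj₁ (trans (det-contract q q₀≢0) det≡1 , uncontract-Terminates q q₀≢0 t)
...   | inj₂ (det≡0 , ¬t) = inj₂ (trans (det-contract q q₀≢0) det≡0 , λ t → ¬t λ i → contract-Terminates q (t (suc i)))

-- Parent maps and arborescences

⌊≟⌋-refl : ∀ {n} (i : Fin n) → ⌊ i ≟ i ⌋ ≡ true
⌊≟⌋-refl i with i ≟ i
... | yes _  = refl
... | no i≢i = contradiction refl i≢i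

⌊≟⌋-≢ : ∀ {n} {i j : Fin n} → i ≢ j → ⌊ i ≟ j ⌋ ≡ false
⌊≟⌋-≢ {i = i} {j} i≢j with i ≟ j
... | yes i≡j = contradiction i≡j i≢j
... | no _    = refl

⌊≟⌋⇒≡ : ∀ {n} (i j : Fin n) → ⌊ i ≟ j ⌋ ≡ true → i ≡ j
⌊≟⌋⇒≡ i j eq with i ≟ j
... | yes i≡j = i≡j

allTrue⁻ : ∀ {n} (P : Fin n → Bool) → allTrue P ≡ true → ∀ i → P i ≡ true
allTrue⁻ {suc n} P all i with P zero in P₀
allTrue⁻ {suc n} P all zero    | true = P₀
allTrue⁻ {suc n} P all (suc i) | true = allTrue⁻ (P ∘ suc) all i

allTrue⁺ : ∀ {n} (P : Fin n → Bool) → (∀ i → P i ≡ true) → allTrue P ≡ true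
allTrue⁺ {zero}  P all = refl
allTrue⁺ {suc n} P all = cong₂ _∧_ (all zero) (allTrue⁺ (P ∘ suc) (all ∘ suc))

iterate-shift : ∀ {A : Set} (f : A → A) m x → iterate f m (f x) ≡ iterate f (suc m) x
iterate-shift f zero    x = refl
iterate-shift f (suc m) x = cong f (iterate-shift f m x)

iterate-+ : ∀ {A : Set} (f : A → A) m n x → iterate f (m ℕ.+ n) x ≡ iterate f m (iterate f n x)
iterate-+ f zero    n x = refl
iterate-+ f (suc m) n x = cong f (iterate-+ f m n x)

iterate-fixed : ∀ {A : Set} (f : A → A) m {x} → f x ≡ x → iterate f m x ≡ x
iterate-fixed f zero    fx≡x = refl
iterate-fixed f (suc m) fx≡x = trans (cong f (iterate-fixed f m fx≡x)) fx≡x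

iterate-periodic : ∀ {A : Set} (f : A → A) t c {x} → iterate f c x ≡ x → iterate f (t ℕ.* c) x ≡ x
iterate-periodic f zero    c eq = refl
iterate-periodic f (suc t) c {x} eq =
  trans (iterate-+ f c (t ℕ.* c) x) (trans (cong (iterate f c) (iterate-periodic f t c eq)) eq)

iterate-cong : ∀ {A : Set} {f g : A → A} → (∀ x → f x ≡ g x) → ∀ m x → iterate f m x ≡ iterate g m x
iterate-cong f≗g zero    x = refl
iterate-cong {g = g} f≗g (suc m) x = trans (f≗g _) (cong g (iterate-cong f≗g m x))

-- Among the first k + 1 points of an orbit two coincide, so an orbit that
-- reaches a fixed point at all does so within k steps.
iterate-within : ∀ {k} (f : Fin k → Fin k) {z} → f z ≡ z → ∀ m v → iterate f m v ≡ z → iterate f k v ≡ z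
iterate-within {k} f {z} fz≡z m v reaches
  with i , j , i<j , eq ← pigeonhole (ℕP.n<1+n k) (λ i → iterate f (toℕ i) v) = begin
  iterate f k v                            ≡⟨ cong (λ n → iterate f n v) (ℕP.m∸n+n≡m a≤k) ⟨
  iterate f (k ℕ.∸ a ℕ.+ a) v              ≡⟨ iterate-+ f (k ℕ.∸ a) a v ⟩
  iterate f (k ℕ.∸ a) (iterate f a v)      ≡⟨ cong (iterate f (k ℕ.∸ a)) reached ⟩
  iterate f (k ℕ.∸ a) z                    ≡⟨ iterate-fixed f (k ℕ.∸ a) fz≡z ⟩
  z                                        ∎
  where
  a = toℕ i
  c = toℕ j ℕ.∸ a
  instance
    c≢0 : ℕ.NonZero c
    c≢0 = ℕ.>-nonZero (ℕP.m<n⇒0<n∸m i<j)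
  a≤k : a ℕ.≤ k
  a≤k = ℕ.s≤s⁻¹ (toℕ<n i)
  period : iterate f c (iterate f a v) ≡ iterate f a v
  period = trans (sym (iterate-+ f c a v))
    (trans (cong (λ n → iterate f n v) (ℕP.m∸n+n≡m (ℕP.<⇒≤ i<j))) (sym eq))
  late : m ℕ.≤ m ℕ.* c ℕ.+ a
  late = ℕP.≤-trans (ℕP.m≤m*n m c) (ℕP.m≤m+n (m ℕ.* c) a)
  reached : iterate f a v ≡ z
  reached = begin
    iterate f a v                                        ≡⟨ iterate-periodic f m c period ⟨
    iterate f (m ℕ.* c) (iterate f a v)                  ≡⟨ iterate-+ f (m ℕ.* c) a v ⟨
    iterate f (m ℕ.* c ℕ.+ a) v                          ≡⟨ cong (λ n → iterate f n v) (ℕP.m∸n+n≡m late) ⟨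
    iterate f (m ℕ.* c ℕ.+ a ℕ.∸ m ℕ.+ m) v              ≡⟨ iterate-+ f (m ℕ.* c ℕ.+ a ℕ.∸ m) m v ⟩
    iterate f (m ℕ.* c ℕ.+ a ℕ.∸ m) (iterate f m v)      ≡⟨ cong (iterate f (m ℕ.* c ℕ.+ a ℕ.∸ m)) reaches ⟩
    iterate f (m ℕ.* c ℕ.+ a ℕ.∸ m) z                    ≡⟨ iterate-fixed f (m ℕ.* c ℕ.+ a ℕ.∸ m) fz≡z ⟩
    z                                                    ∎

parents : ∀ {k} → Fin k → (Fin k → Fin k) → PartialMap k
parents z p v = if ⌊ v ≟ z ⌋ then nothing else just (p v)

module _ {k} {z : Fin k} {p : Fin k → Fin k} where

  Terminates⇒reaches : ∀ {v} → Terminates (parents z p) v → ∃ λ m → iterate p m v ≡ z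
  Terminates⇒reaches {v} (halt eq) with v ≟ z
  ... | yes v≡z = 0 , v≡z
  ... | no  _   with () ← eq
  Terminates⇒reaches {v} (step eq t) with v ≟ z
  ... | yes v≡z = 0 , v≡z
  ... | no  _   with refl ← eq | m , reaches ← Terminates⇒reaches t =
    suc m , trans (sym (iterate-shift p m v)) reaches

  reaches⇒Terminates : ∀ m {v} → iterate p m v ≡ z → Terminates (parents z p) v
  reaches⇒Terminates m {v} reaches with v ≟ z
  ... | yes v≡z = halt (cong (λ b → if b then nothing else just (p v)) (trans (cong (λ u → ⌊ u ≟ z ⌋) v≡z) (⌊≟⌋-refl z)))
  reaches⇒Terminates zero    {v} reaches | no v≢z = contradiction reaches v≢z
  reaches⇒Terminates (suc m) {v} reaches | no v≢z =
    step (cong (λ b → if b then nothing else just (p v)) (⌊≟⌋-≢ v≢z))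
         (reaches⇒Terminates m (trans (iterate-shift p m v) reaches))

-- Breadth-first spanning trees

module Reachability {k} (E : Fin k → Fin k → Set) (E? : ∀ v u → Dec (E v u)) (z : Fin k) where

  Within : ℕ → Fin k → Set
  Within zero    v = v ≡ z
  Within (suc n) v = Within n v ⊎ ∃ λ u → E v u × Within n u

  within? : ∀ n v → Dec (Within n v)
  within? zero    v = v ≟ z
  within? (suc n) v = within? n v ⊎-dec any? (λ u → E? v u ×-dec within? n u)

  within-mono : ∀ {m n v} → m ℕ.≤′ n → Within m v → Within n v
  within-mono ℕ.≤′-refl        w = w
  within-mono (ℕ.≤′-step m≤n) w = inj₁ (within-mono m≤n w)

  -- Moving to `u` improves every bound on the distance to `z` at once; this puts `u` next on a
  -- shortest walk without naming the distance.
  Parent : Fin k → Fin k → Set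
  Parent v u = E v u × (∀ m → Within (suc m) v → Within m u)

  -- The bound is lowered until `v` is no longer within it; the edge used at the level just above
  -- leads one step closer.
  parent : ∀ {v} → v ≢ z → ∀ n → Within n v → ∃ (Parent v)
  parent v≢z zero    v≡z      = contradiction v≡z v≢z
  parent v≢z (suc n) (inj₁ w) = parent v≢z n w
  parent {v} v≢z (suc n) (inj₂ (u , e , w)) with within? n v
  ... | yes w′ = parent v≢z n w′
  ... | no  ¬w = u , e , closer
    where
    closer : ∀ m → Within (suc m) v → Within m u
    closer m wm with n ℕP.≤? m
    ... | yes n≤m = within-mono (ℕP.≤⇒≤′ n≤m) w
    ... | no  n≰m = contradiction (within-mono (ℕP.≤⇒≤′ (ℕP.≰⇒> n≰m)) wm) ¬w

  spanningTree : (∀ v → ∃ λ n → Within n v) →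
    Σ[ p ∈ (Fin k → Fin k) ] p z ≡ z × (∀ v → v ≢ z → E v (p v)) × (∀ v → ∃ λ m → iterate p m v ≡ z)
  spanningTree reach = p , p-root , p-edge , λ v → proj₁ (reach v) , descend (proj₁ (reach v)) (proj₂ (reach v))
    where
    p : Fin k → Fin k
    p v with v ≟ z
    ... | yes _  = z
    ... | no v≢z = proj₁ (parent v≢z (proj₁ (reach v)) (proj₂ (reach v)))
    p-root : p z ≡ z
    p-root with z ≟ z
    ... | yes _  = refl
    ... | no z≢z = contradiction refl z≢z
    p-parent : ∀ v → v ≢ z → Parent v (p v)
    p-parent v v≢z with v ≟ z
    ... | yes v≡z = contradiction v≡z v≢z
    ... | no v≢z′ = proj₂ (parent v≢z′ (proj₁ (reach v)) (proj₂ (reach v)))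
    p-edge : ∀ v → v ≢ z → E v (p v)
    p-edge v v≢z = proj₁ (p-parent v v≢z)
    descend : ∀ m {v} → Within m v → iterate p m v ≡ z
    descend zero        v≡z = v≡z
    descend (suc m) {v} w with v ≟ z
    ... | yes refl = iterate-fixed p (suc m) p-root
    ... | no  v≢z  = trans (sym (iterate-shift p m v)) (descend m (proj₂ (p-parent v v≢z) m w))

-- Only up to pointwise equality, since listed functions are assembled by `consFun`; properties of a
-- parent map are later carried over to its listed copy.
allFunctions-complete : ∀ n k (f : Fin n → Fin k) → Any (λ g → ∀ i → g i ≡ f i) (allFunctions n k)
allFunctions-complete zero    k f = here λ ()
allFunctions-complete (suc n) k f = AnyP.concatMap⁺ (λ g → map (λ x → consFun x g) (allFin k))
  (Any.map (λ g≗f → AnyP.map⁺ (AnyP.tabulate⁺ (f zero) λ { zero → refl ; (suc i) → g≗f i }))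
           (allFunctions-complete n k (f ∘ suc)))

sumList-≢0 : ∀ {A : Set} {w : A → ℕ} {xs} → Any (λ x → w x ≢ 0) xs → sumList (map w xs) ≢ 0
sumList-≢0 {w = w} (here {x} wx≢0) eq = wx≢0 (ℕP.m+n≡0⇒m≡0 (w x) eq)
sumList-≢0 {w = w} (there {x} any) eq = sumList-≢0 any (ℕP.m+n≡0⇒n≡0 (w x) eq)

sumℕ-≢0 : ∀ {n} (f : Fin n → ℕ) i → f i ≢ 0 → sumℕ f ≢ 0
sumℕ-≢0 f zero    fi≢0 eq = fi≢0 (ℕP.m+n≡0⇒m≡0 (f zero) eq)
sumℕ-≢0 f (suc i) fi≢0 eq = sumℕ-≢0 (f ∘ suc) i fi≢0 (ℕP.m+n≡0⇒n≡0 (f zero) eq)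

prodℕ-≢0 : ∀ {n} (f : Fin n → ℕ) → (∀ i → f i ≢ 0) → prodℕ f ≢ 0
prodℕ-≢0 {zero}  f f≢0 ()
prodℕ-≢0 {suc n} f f≢0 eq with ℕP.m*n≡0⇒m≡0∨n≡0 (f zero) eq
... | inj₁ f₀≡0   = f≢0 zero f₀≡0
... | inj₂ rest≡0 = prodℕ-≢0 (f ∘ suc) (f≢0 ∘ suc) rest≡0

prodℤ-zero : ∀ {n} (f : Fin n → ℤ) i → f i ≡ 0ℤ → prodℤ f ≡ 0ℤ
prodℤ-zero f zero    fi≡0 = cong (_* prodℤ (f ∘ suc)) fi≡0
prodℤ-zero f (suc i) fi≡0 = trans (cong (f zero *_) (prodℤ-zero (f ∘ suc) i fi≡0)) (ℤP.*-zeroʳ (f zero))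

prodℤ-pos : ∀ {n} (f : Fin n → ℤ) (g : Fin n → ℕ) → (∀ i → f i ≡ pos (g i)) → prodℤ f ≡ pos (prodℕ g)
prodℤ-pos {zero}  f g f≗g = refl
prodℤ-pos {suc n} f g f≗g = trans (cong₂ _*_ (f≗g zero) (prodℤ-pos (f ∘ suc) (g ∘ suc) (f≗g ∘ suc)))
                                  (sym (ℤP.pos-* (g zero) (prodℕ (g ∘ suc))))

pos-sumℕ : ∀ {n} (f : Fin n → ℕ) → pos (sumℕ f) ≡ sumℤ (pos ∘ f)
pos-sumℕ {zero}  f = refl
pos-sumℕ {suc n} f = cong (pos (f zero) +_) (pos-sumℕ (f ∘ suc))

pos-sumList : ∀ {A : Set} (w : A → ℕ) xs → pos (sumList (map w xs)) ≡ sumOver xs (pos ∘ w)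
pos-sumList w []       = refl
pos-sumList w (x ∷ xs) = cong (pos (w x) +_) (pos-sumList w xs)

-- The digraph of a coloured triangulation

module _ (𝒢 : ColouredSphereTriangulation) where
  open ColouredSphereTriangulation 𝒢

  blackR : Fin m → Fin k
  blackR w = bR (glueCS ⟨$⟩ʳ w)

  pos-edgeCount : ∀ i j → pos (edgeCount 𝒢 i j) ≡ sumℤ (λ w → δ (wR w) j * δ (blackR w) i)
  pos-edgeCount i j = trans
    (pos-sumℕ (λ w → if ⌊ wR w ≟ j ⌋ ∧ ⌊ blackR w ≟ i ⌋ then 1 else 0)) (sumℤ-cong indicator)
    where
    indicator : ∀ w → pos (if ⌊ wR w ≟ j ⌋ ∧ ⌊ blackR w ≟ i ⌋ then 1 else 0) ≡ δ (wR w) j * δ (blackR w) i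
    indicator w with wR w ≟ j | blackR w ≟ i
    ... | yes refl | yes refl = sym (cong₂ _*_ (δ-refl (wR w)) (δ-refl (blackR w)))
    ... | yes refl | no  b≢i  = sym (trans (cong (δ (wR w) (wR w) *_) (δ-≢ b≢i)) (ℤP.*-zeroʳ (δ (wR w) (wR w))))
    ... | no  w≢j  | _        = sym (cong (_* δ (blackR w) i) (δ-≢ w≢j))

  -- A C-S edge may have the same R-vertex on both sides, so `edgeCount` can have a nonzero
  -- diagonal. Removing it by means of `δ` keeps the sums below linear.
  pos-offDiag : ∀ i j → pos (offDiag 𝒢 i j) ≡ pos (edgeCount 𝒢 i j) - δ i j * pos (edgeCount 𝒢 i i)
  pos-offDiag i j with i ≟ j
  ... | yes refl = sym (trans (cong (λ d → pos (edgeCount 𝒢 i i) - d * pos (edgeCount 𝒢 i i)) (δ-refl i))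
                              (cancel (pos (edgeCount 𝒢 i i))))
    where
    cancel : ∀ e → e - 1ℤ * e ≡ 0ℤ
    cancel = solve-∀
  ... | no i≢j = sym (trans (cong (λ d → pos (edgeCount 𝒢 i j) - d * pos (edgeCount 𝒢 i i)) (δ-≢ i≢j))
                            (ℤP.+-identityʳ (pos (edgeCount 𝒢 i j))))

  T-offDiag : ∀ i j → T 𝒢 i j ≡ pos (offDiag 𝒢 i j) - δ i j * pos (sumℕ (offDiag 𝒢 i))
  T-offDiag i j with i ≟ j
  ... | yes refl = sym (trans (cong (λ d → 0ℤ - d * s) (δ-refl i)) (simplify s))
    where
    s = pos (sumℕ (offDiag 𝒢 i))
    simplify : ∀ s → 0ℤ - 1ℤ * s ≡ - s
    simplify = solve-∀
  ... | no i≢j = sym (trans (cong (λ d → pos (edgeCount 𝒢 i j) - d * pos (sumℕ (offDiag 𝒢 i))) (δ-≢ i≢j))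
                            (ℤP.+-identityʳ (pos (edgeCount 𝒢 i j))))

  T-rowSum : ∀ i → sumℤ (T 𝒢 i) ≡ 0ℤ
  T-rowSum i = begin
    sumℤ (T 𝒢 i)
      ≡⟨ sumℤ-cong (T-offDiag i) ⟩
    sumℤ (λ j → t j - δ i j * s)
      ≡⟨ sumℤ-+ t (λ j → - (δ i j * s)) ⟩
    sumℤ t + sumℤ (λ j → - (δ i j * s))
      ≡⟨ cong (sumℤ t +_) (sumℤ-neg (λ j → δ i j * s)) ⟩
    sumℤ t - sumℤ (λ j → δ i j * s)
      ≡⟨ cong₂ _-_ (sym (pos-sumℕ (offDiag 𝒢 i))) (sumℤ-δ i (λ _ → s)) ⟩
    s - s
      ≡⟨ ℤP.+-inverseʳ s ⟩
    0ℤ ∎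
    where
    t : Fin k → ℤ
    t j = pos (offDiag 𝒢 i j)
    s = pos (sumℕ (offDiag 𝒢 i))

  -- Both sides count the triangles of one colour at r_j, and the two colours
  -- are matched by the gluing along the RC-edges.
  edgeCount-balanced : ∀ j → sumℤ (λ i → pos (edgeCount 𝒢 i j)) ≡ sumℤ (λ i → pos (edgeCount 𝒢 j i))
  edgeCount-balanced j = begin
    sumℤ (λ i → pos (edgeCount 𝒢 i j))
      ≡⟨ sumℤ-cong (λ i → pos-edgeCount i j) ⟩
    sumℤ (λ i → sumℤ (λ w → δ (wR w) j * δ (blackR w) i))
      ≡⟨ sumℤ-comm (λ i w → δ (wR w) j * δ (blackR w) i) ⟩
    sumℤ (λ w → sumℤ (λ i → δ (wR w) j * δ (blackR w) i))
      ≡⟨ sumℤ-cong (λ w → trans (sumℤ-cong (λ i → ℤP.*-comm (δ (wR w) j) (δ (blackR w) i)))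
                                (sumℤ-δ (blackR w) (λ _ → δ (wR w) j))) ⟩
    sumℤ (λ w → δ (wR w) j)
      ≡⟨ sumℤ-cong (λ w → cong (λ v → δ v j) (glueRC-R w)) ⟨
    sumℤ (λ w → δ (bR (glueRC ⟨$⟩ʳ w)) j)
      ≡⟨ sumℤ-permute glueRC (λ b → δ (bR b) j) ⟩
    sumℤ (λ b → δ (bR b) j)
      ≡⟨ sumℤ-permute glueCS (λ b → δ (bR b) j) ⟨
    sumℤ (λ w → δ (blackR w) j)
      ≡⟨ sumℤ-cong (λ w → sumℤ-δ (wR w) (λ _ → δ (blackR w) j)) ⟨
    sumℤ (λ w → sumℤ (λ i → δ (wR w) i * δ (blackR w) j))
      ≡⟨ sumℤ-comm (λ w i → δ (wR w) i * δ (blackR w) j) ⟩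
    sumℤ (λ i → sumℤ (λ w → δ (wR w) i * δ (blackR w) j))
      ≡⟨ sumℤ-cong (λ i → pos-edgeCount j i) ⟨
    sumℤ (λ i → pos (edgeCount 𝒢 j i)) ∎

  offDiag-balanced : ∀ j → sumℤ (λ i → pos (offDiag 𝒢 i j)) ≡ sumℤ (λ i → pos (offDiag 𝒢 j i))
  offDiag-balanced j = begin
    sumℤ (λ i → pos (offDiag 𝒢 i j))
      ≡⟨ sumℤ-cong (λ i → pos-offDiag i j) ⟩
    sumℤ (λ i → e i j - δ i j * e i i)
      ≡⟨ sumℤ-+ (λ i → e i j) (λ i → - (δ i j * e i i)) ⟩
    sumℤ (λ i → e i j) + sumℤ (λ i → - (δ i j * e i i))
      ≡⟨ cong₂ _+_ (edgeCount-balanced j) (trans (sumℤ-neg (λ i → δ i j * e i i))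
           (cong -_ (trans (sumℤ-δʳ j (λ i → e i i)) (sym (sumℤ-δ j (λ _ → e j j)))))) ⟩
    sumℤ (e j) - sumℤ (λ i → δ j i * e j j)
      ≡⟨ cong (sumℤ (e j) +_) (sumℤ-neg (λ i → δ j i * e j j)) ⟨
    sumℤ (e j) + sumℤ (λ i → - (δ j i * e j j))
      ≡⟨ sumℤ-+ (e j) (λ i → - (δ j i * e j j)) ⟨
    sumℤ (λ i → e j i - δ j i * e j j)
      ≡⟨ sumℤ-cong (λ i → pos-offDiag j i) ⟨
    sumℤ (λ i → pos (offDiag 𝒢 j i)) ∎
    where
    e : Fin k → Fin k → ℤ
    e i j = pos (edgeCount 𝒢 i j)

  T-columnSum : ∀ j → sumℤ (λ i → T 𝒢 i j) ≡ 0ℤ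
  T-columnSum j = begin
    sumℤ (λ i → T 𝒢 i j)
      ≡⟨ sumℤ-cong (λ i → T-offDiag i j) ⟩
    sumℤ (λ i → pos (offDiag 𝒢 i j) - δ i j * s i)
      ≡⟨ sumℤ-+ (λ i → pos (offDiag 𝒢 i j)) (λ i → - (δ i j * s i)) ⟩
    sumℤ (λ i → pos (offDiag 𝒢 i j)) + sumℤ (λ i → - (δ i j * s i))
      ≡⟨ cong₂ _+_ (trans (offDiag-balanced j) (sym (pos-sumℕ (offDiag 𝒢 j))))
                   (trans (sumℤ-neg (λ i → δ i j * s i)) (cong -_ (sumℤ-δʳ j s))) ⟩
    s j - s j
      ≡⟨ ℤP.+-inverseʳ (s j) ⟩
    0ℤ ∎
    where
    s : Fin k → ℤ
    s i = pos (sumℕ (offDiag 𝒢 i))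

  -- Strong connectedness and nonvanishing of the tree number

  Arc : Fin k → Fin k → Set
  -- The edge of the digraph runs from `u` to `v`, so `u` is a possible parent of `v`.
  Arc v u = offDiag 𝒢 v u ≢ 0

  edge⇒Arc : ∀ w → blackR w ≢ wR w → Arc (blackR w) (wR w)
  edge⇒Arc w b≢w rewrite ⌊≟⌋-≢ b≢w =
    sumℕ-≢0 (λ x → if ⌊ wR x ≟ wR w ⌋ ∧ ⌊ blackR x ≟ blackR w ⌋ then 1 else 0) w counted
    where
    counted : (if ⌊ wR w ≟ wR w ⌋ ∧ ⌊ blackR w ≟ blackR w ⌋ then 1 else 0) ≢ 0
    counted rewrite ⌊≟⌋-refl (wR w) | ⌊≟⌋-refl (blackR w) = λ ()

  module _ (z : Fin k) where
    open Reachability Arc (λ v u → ¬? (offDiag 𝒢 v u ℕP.≟ 0)) z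

    private
      rotations = select3 (rotate glueRC glueRS) (rotate glueRC glueCS) (rotate glueRS glueCS)

    -- The white face reached lies across its C-S edge from the image of `w` under `g`, and `g`
    -- preserves the R-vertex.
    rotate-GlueCS : ∀ (g : Permutation′ m) → (∀ w → bR (g ⟨$⟩ʳ w) ≡ wR w) → ∀ w → blackR (rotate g glueCS w) ≡ wR w
    rotate-GlueCS g g-R w = trans (cong bR (inverseʳ glueCS)) (g-R w)

    arcStep : ∀ w w′ → blackR w′ ≡ wR w → ∃ (λ n → Within n (wR w′)) → ∃ (λ n → Within n (wR w))
    arcStep w w′ b≡ (n , within) with blackR w′ ≟ wR w′
    ... | yes b≡w = n , subst (Within n) (trans (sym b≡w) b≡) within
    ... | no  b≢w = suc n , inj₂ (wR w′ , subst (λ v → Arc v (wR w′)) b≡ (edge⇒Arc w′ b≢w) , within)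

    -- Rotation about an R-vertex keeps that vertex; the other two rotations cross a C-S edge, hence
    -- follow an arc or stay at the same R-vertex. A word joining two faces thus gives a walk
    -- joining their R-vertices.
    within-word : ∀ word w → wR (applyWord rotations word w) ≡ z → ∃ λ n → Within n (wR w)
    within-word []                     w eq = 0 , eq
    within-word (zero ∷ word)          w eq with within-word word (rotate glueRC glueRS w) eq
    ... | n , within = n , subst (Within n) same-R within
      where
      same-R : wR (rotate glueRC glueRS w) ≡ wR w
      same-R = trans (sym (glueRS-R (rotate glueRC glueRS w))) (trans (cong bR (inverseʳ glueRS)) (glueRC-R w))
    within-word (suc zero ∷ word)       w eq =
      arcStep w (rotate glueRC glueCS w) (rotate-GlueCS glueRC glueRC-R w) (within-word word _ eq)
    within-word (suc (suc zero) ∷ word) w eq =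
      arcStep w (rotate glueRS glueCS w) (rotate-GlueCS glueRS glueRS-R w) (within-word word _ eq)

    within-all : ∀ v → ∃ λ n → Within n v
    within-all v with R-used v | R-used z
    ... | w , refl | w₀ , w₀≡z with connected w w₀
    ... | word , eq = within-word word w (trans (cong wR eq) w₀≡z)

    isParentMap⁺ : ∀ p → p z ≡ z → (∀ v → ∃ λ m → iterate p m v ≡ z) → isParentMap 𝒢 z p ≡ true
    isParentMap⁺ p pz≡z reach = cong₂ _∧_ (trans (cong (λ u → ⌊ u ≟ z ⌋) pz≡z) (⌊≟⌋-refl z))
      (allTrue⁺ (λ v → ⌊ iterate p k v ≟ z ⌋) λ v →
        trans (cong (λ u → ⌊ u ≟ z ⌋) (iterate-within p pz≡z (proj₁ (reach v)) v (proj₂ (reach v)))) (⌊≟⌋-refl z))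

    arbWeight-≢0 : ∀ p → (∀ v → v ≢ z → Arc v (p v)) → arbWeight 𝒢 z p ≢ 0
    arbWeight-≢0 p arcs = prodℕ-≢0 (λ v → if ⌊ v ≟ z ⌋ then 1 else offDiag 𝒢 v (p v)) factor
      where
      factor : ∀ v → (if ⌊ v ≟ z ⌋ then 1 else offDiag 𝒢 v (p v)) ≢ 0
      factor v with v ≟ z
      ... | yes _  = λ ()
      ... | no v≢z = arcs v v≢z

    weight : (Fin k → Fin k) → ℕ
    weight p = if isParentMap 𝒢 z p then arbWeight 𝒢 z p else 0

    -- Natural summands cannot cancel, so the breadth-first tree, whose weight is nonzero, suffices.
    treeNumber-≢0 : treeNumber 𝒢 z ≢ 0
    treeNumber-≢0 with p , pz≡z , arcs , reach ← spanningTree within-all =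
      sumList-≢0 (Any.map weight-≢0 (allFunctions-complete k k p))
      where
      weight-≢0 : ∀ {g} → (∀ v → g v ≡ p v) → weight g ≢ 0
      weight-≢0 {g} g≗p rewrite isParentMap⁺ g (trans (g≗p z) pz≡z)
          (λ v → proj₁ (reach v) , trans (iterate-cong g≗p (proj₁ (reach v)) v) (proj₂ (reach v))) =
        arbWeight-≢0 g (λ v v≢z → subst (Arc v) (sym (g≗p v)) (arcs v v≢z))

    -- The matrix-tree theorem

    coefficient : Fin k → Fin k → ℤ
    -- In the root row only `l = z` survives, which kills every choice with `p z ≢ z`.
    coefficient i l = if ⌊ i ≟ z ⌋ then δ z l else pos (offDiag 𝒢 i l)

    -- For `l = p i` this is definitionally row `i` of `graphMatrix (parents z p)`, so the expansion
    -- ends in determinants of functional graphs.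
    elementaryRow : Fin k → Fin k → Fin k → ℤ
    elementaryRow i l j = δ i j - target (if ⌊ i ≟ z ⌋ then nothing else just l) j

    -- - T with row z replaced by the unit vector at z, written so that the
    -- multilinear expansion of its determinant runs over the parent maps.
    rootedLaplacian : Matrix k k
    rootedLaplacian = combination coefficient elementaryRow

    rootedLaplacian-root : ∀ j → rootedLaplacian z j ≡ δ z j
    rootedLaplacian-root j rewrite ⌊≟⌋-refl z =
      trans (sumℤ-δ z (λ _ → δ z j - 0ℤ)) (ℤP.+-identityʳ (δ z j))

    rootedLaplacian-nonroot : ∀ {i} → i ≢ z → ∀ j → rootedLaplacian i j ≡ - T 𝒢 i j
    rootedLaplacian-nonroot {i} i≢z j rewrite ⌊≟⌋-≢ i≢z = begin
      sumℤ (λ l → t l * (δ i j - δ l j))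
        ≡⟨ sumℤ-cong (λ l → distribute (t l) (δ i j) (δ l j)) ⟩
      sumℤ (λ l → δ i j * t l + - (δ l j * t l))
        ≡⟨ sumℤ-+ (λ l → δ i j * t l) (λ l → - (δ l j * t l)) ⟩
      sumℤ (λ l → δ i j * t l) + sumℤ (λ l → - (δ l j * t l))
        ≡⟨ cong₂ _+_ (trans (sym (*-distribˡ-sumℤ (δ i j) t)) (cong (δ i j *_) (sym (pos-sumℕ (offDiag 𝒢 i)))))
                     (trans (sumℤ-neg (λ l → δ l j * t l)) (cong -_ (sumℤ-δʳ j t))) ⟩
      δ i j * pos (sumℕ (offDiag 𝒢 i)) - t j
        ≡⟨ negate (δ i j * pos (sumℕ (offDiag 𝒢 i))) (t j) ⟩
      - (t j - δ i j * pos (sumℕ (offDiag 𝒢 i)))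
        ≡⟨ cong -_ (T-offDiag i j) ⟨
      - T 𝒢 i j ∎
      where
      t : Fin k → ℤ
      t l = pos (offDiag 𝒢 i l)
      distribute : ∀ t a b → t * (a - b) ≡ a * t + - (b * t)
      distribute = solve-∀
      negate : ∀ a b → a - b ≡ - (b - a)
      negate = solve-∀

    -- The determinant is decided by termination of all orbits, the weight by arrival within `k`
    -- steps. These agree once `p z ≡ z`, so the mixed cases are contradictory.
    matrixTree-term : ∀ p → prodℤ (λ i → coefficient i (p i)) * det (graphMatrix (parents z p)) ≡ pos (weight p)
    matrixTree-term p with p z ≟ z
    ... | no pz≢z = cong (_* det (graphMatrix (parents z p)))
      (prodℤ-zero (λ i → coefficient i (p i)) z root-factor)
      where
      root-factor : coefficient z (p z) ≡ 0ℤ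
      root-factor rewrite ⌊≟⌋-refl z = δ-≢ (pz≢z ∘ sym)
    ... | yes pz≡z with allTrue (λ v → ⌊ iterate p k v ≟ z ⌋) in all | det-graphMatrix (parents z p)
    ...   | true  | inj₂ (_ , ¬t) = contradiction
      (λ v → reaches⇒Terminates k (⌊≟⌋⇒≡ (iterate p k v) z (allTrue⁻ (λ v → ⌊ iterate p k v ≟ z ⌋) all v))) ¬t
    ...   | false | inj₁ (_ , t) = contradiction (trans (sym all) (allTrue⁺ _ λ v →
      let m , reaches = Terminates⇒reaches (t v) in
      trans (cong (λ u → ⌊ u ≟ z ⌋) (iterate-within p pz≡z m v reaches)) (⌊≟⌋-refl z))) λ ()
    ...   | false | inj₂ (det≡0 , _) =
      trans (cong (prodℤ (λ i → coefficient i (p i)) *_) det≡0) (ℤP.*-zeroʳ (prodℤ (λ i → coefficient i (p i))))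
    ...   | true  | inj₁ (det≡1 , _) = begin
      prodℤ (λ i → coefficient i (p i)) * det (graphMatrix (parents z p))
        ≡⟨ cong (prodℤ (λ i → coefficient i (p i)) *_) det≡1 ⟩
      prodℤ (λ i → coefficient i (p i)) * 1ℤ
        ≡⟨ ℤP.*-identityʳ (prodℤ (λ i → coefficient i (p i))) ⟩
      prodℤ (λ i → coefficient i (p i))
        ≡⟨ prodℤ-pos (λ i → coefficient i (p i)) (λ i → if ⌊ i ≟ z ⌋ then 1 else offDiag 𝒢 i (p i)) factor ⟩
      pos (arbWeight 𝒢 z p) ∎
      where
      factor : ∀ i → coefficient i (p i) ≡ pos (if ⌊ i ≟ z ⌋ then 1 else offDiag 𝒢 i (p i))
      factor i with i ≟ z
      ... | yes refl = trans (cong (δ i) pz≡z) (δ-refl i)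
      ... | no  _    = refl

    matrixTree : det rootedLaplacian ≡ pos (treeNumber 𝒢 z)
    matrixTree = begin
      det rootedLaplacian
        ≡⟨ det-multilinear k coefficient elementaryRow ⟩
      sumOver (allFunctions k k) (λ p → prodℤ (λ i → coefficient i (p i)) * det (graphMatrix (parents z p)))
        ≡⟨ sumOver-cong (allFunctions k k) matrixTree-term ⟩
      sumOver (allFunctions k k) (λ p → pos (weight p))
        ≡⟨ pos-sumList weight (allFunctions k k) ⟨
      pos (treeNumber 𝒢 z) ∎

    -- The finite summand and the splitting of `𝓑W`

    rootedGroup : AbelianGroup 0ℓ 0ℓ
    rootedGroup = Presentation.presentedGroup rootedLaplacian

    rootedGroup-bijection : Bijection (AbelianGroup.setoid rootedGroup) (setoid (Fin (treeNumber 𝒢 z)))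
    rootedGroup-bijection = record
      { to        = index C
      ; cong      = λ {x} {y} → index-cong C x y
      ; bijective = (λ {x} {y} → index-inj C x y)
                  , λ i → let x , index≡ = index-surj C i in
                      x , λ {w} w≈x → trans (index-cong C w x w≈x) index≡
      }
      where
      ∣det∣≡ : ∣ det rootedLaplacian ∣ ≡ treeNumber 𝒢 z
      ∣det∣≡ = cong ∣_∣ matrixTree
      C : Cokernel rootedLaplacian (treeNumber 𝒢 z)
      C = subst (Cokernel rootedLaplacian) ∣det∣≡
        (cokernel rootedLaplacian (ℕ.≢-nonZero (treeNumber-≢0 ∘ trans (sym ∣det∣≡))))

    -- Zero column sums allow a constant to be subtracted from all coefficients; the choice `c z`
    -- removes row `z`, the one row that was replaced.
    T≈⇒rooted≈ : ∀ {x y} → T 𝒢 ⊢ x ≈ y → rootedLaplacian ⊢ x ≈ y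
    T≈⇒rooted≈ {x} {y} (c , eq) = (λ i → c z - c i) , λ j → begin
      x j - y j
        ≡⟨ eq j ⟩
      lin (T 𝒢) c j
        ≡⟨ ℤP.+-identityʳ (lin (T 𝒢) c j) ⟨
      lin (T 𝒢) c j + 0ℤ
        ≡⟨ cong (lin (T 𝒢) c j +_) (trans (cong (- c z *_) (T-columnSum j)) (ℤP.*-zeroʳ (- c z))) ⟨
      lin (T 𝒢) c j + - c z * sumℤ (λ i → T 𝒢 i j)
        ≡⟨ cong (lin (T 𝒢) c j +_) (*-distribˡ-sumℤ (- c z) (λ i → T 𝒢 i j)) ⟩
      lin (T 𝒢) c j + sumℤ (λ i → - c z * T 𝒢 i j)
        ≡⟨ sumℤ-+ (λ i → c i * T 𝒢 i j) (λ i → - c z * T 𝒢 i j) ⟨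
      sumℤ (λ i → c i * T 𝒢 i j + - c z * T 𝒢 i j)
        ≡⟨ sumℤ-cong (λ i → term i j (i ≟ z)) ⟩
      lin rootedLaplacian (λ i → c z - c i) j ∎
      where
      vanish : ∀ c t r → c * t + - c * t ≡ (c - c) * r
      vanish = solve-∀
      flip : ∀ a b t → a * t + - b * t ≡ (b - a) * - t
      flip = solve-∀
      term : ∀ i j → Dec (i ≡ z) → c i * T 𝒢 i j + - c z * T 𝒢 i j ≡ (c z - c i) * rootedLaplacian i j
      term i j (yes refl) = vanish (c i) (T 𝒢 i j) (rootedLaplacian i j)
      term i j (no i≢z)   = trans (flip (c i) (c z) (T 𝒢 i j))
                                  (cong ((c z - c i) *_) (sym (rootedLaplacian-nonroot i≢z j)))

    rootedLaplacian-rowSum : ∀ {i} → Dec (i ≡ z) → sumℤ (rootedLaplacian i) ≡ δ z i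
    rootedLaplacian-rowSum (yes refl) = begin
      sumℤ (rootedLaplacian z)        ≡⟨ sumℤ-cong rootedLaplacian-root ⟩
      sumℤ (δ z)                      ≡⟨ sumℤ-cong (λ j → ℤP.*-identityʳ (δ z j)) ⟨
      sumℤ (λ j → δ z j * 1ℤ)         ≡⟨ sumℤ-δ z (λ _ → 1ℤ) ⟩
      1ℤ                              ≡⟨ δ-refl z ⟨
      δ z z                           ∎
    rootedLaplacian-rowSum {i} (no i≢z) = begin
      sumℤ (rootedLaplacian i)        ≡⟨ sumℤ-cong (rootedLaplacian-nonroot i≢z) ⟩
      sumℤ (λ j → - T 𝒢 i j)          ≡⟨ sumℤ-neg (T 𝒢 i) ⟩
      - sumℤ (T 𝒢 i)                  ≡⟨ cong -_ (T-rowSum i) ⟩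
      0ℤ                              ≡⟨ δ-≢ (i≢z ∘ sym) ⟨
      δ z i                           ∎

    -- Only the row of the root has a nonzero sum, so equal augmentations force
    -- its coefficient to vanish.
    rooted≈⇒T≈ : ∀ {x y} → sumℤ x ≡ sumℤ y → rootedLaplacian ⊢ x ≈ y → T 𝒢 ⊢ x ≈ y
    rooted≈⇒T≈ {x} {y} sum≡ (c , eq) = (λ i → - c i) , λ j → trans (eq j) (sumℤ-cong (λ i → term i j (i ≟ z)))
      where
      c-root : c z ≡ 0ℤ
      c-root = begin
        c z                                      ≡⟨ sumℤ-δ z c ⟨
        sumℤ (λ i → δ z i * c i)                 ≡⟨ sumℤ-cong (λ i → trans (cong (_* c i) (sym (rootedLaplacian-rowSum (i ≟ z))))
                                                                          (ℤP.*-comm (sumℤ (rootedLaplacian i)) (c i))) ⟩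
        dot c (λ i → sumℤ (rootedLaplacian i))   ≡⟨ sumℤ-lin rootedLaplacian c ⟨
        sumℤ (lin rootedLaplacian c)             ≡⟨ sumℤ-cong eq ⟨
        sumℤ (λ j → x j - y j)                   ≡⟨ sumℤ-difference x y ⟩
        sumℤ x - sumℤ y                          ≡⟨ ℤP.i≡j⇒i-j≡0 sum≡ ⟩
        0ℤ                                       ∎
      flip : ∀ c t → c * - t ≡ - c * t
      flip = solve-∀
      term : ∀ i j → Dec (i ≡ z) → c i * rootedLaplacian i j ≡ - c i * T 𝒢 i j
      term i j (yes refl) = trans (cong (_* rootedLaplacian i j) c-root) (cong (λ x → - x * T 𝒢 i j) (sym c-root))
      term i j (no i≢z)   = trans (cong (c i *_) (rootedLaplacian-nonroot i≢z j)) (flip (c i) (T 𝒢 i j))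

    T≈⇒sum≡ : ∀ {x y} → T 𝒢 ⊢ x ≈ y → sumℤ x ≡ sumℤ y
    T≈⇒sum≡ {x} {y} (c , eq) = ℤP.i-j≡0⇒i≡j (sumℤ x) (sumℤ y) (begin
      sumℤ x - sumℤ y                  ≡⟨ sumℤ-difference x y ⟨
      sumℤ (λ j → x j - y j)           ≡⟨ sumℤ-cong eq ⟩
      sumℤ (lin (T 𝒢) c)               ≡⟨ sumℤ-lin (T 𝒢) c ⟩
      dot c (λ i → sumℤ (T 𝒢 i))       ≡⟨ sumℤ-zero (λ i → c i * sumℤ (T 𝒢 i))
                                            (λ i → trans (cong (c i *_) (T-rowSum i)) (ℤP.*-zeroʳ (c i))) ⟩
      0ℤ                               ∎)

    splitting : (Fin k → ℤ) → AbelianGroup.Carrier (abelianGroup +-0-abelianGroup rootedGroup)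
    splitting x = sumℤ x , x

    -- The unit vector at `z` is a row of the matrix, hence zero in the cokernel; a multiple of it
    -- adjusts the augmentation freely.
    splitting-surjective : ∀ s c → Σ[ x ∈ (Fin k → ℤ) ] sumℤ x ≡ s × rootedLaplacian ⊢ x ≈ c
    splitting-surjective s c = (λ j → c j + δ z j * a) , sum≡ , (λ i → δ z i * a) , λ j → begin
      c j + δ z j * a - c j                        ≡⟨ cancel (c j) (δ z j) a ⟩
      a * δ z j                                    ≡⟨ cong (a *_) (rootedLaplacian-root j) ⟨
      a * rootedLaplacian z j                      ≡⟨ sumℤ-δ z (λ i → a * rootedLaplacian i j) ⟨
      sumℤ (λ i → δ z i * (a * rootedLaplacian i j)) ≡⟨ sumℤ-cong (λ i → ℤP.*-assoc (δ z i) a (rootedLaplacian i j)) ⟨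
      lin rootedLaplacian (λ i → δ z i * a) j      ∎
      where
      a = s - sumℤ c
      cancel : ∀ c d a → c + d * a - c ≡ a * d
      cancel = solve-∀
      complete : ∀ s c → c + (s - c) ≡ s
      complete = solve-∀
      sum≡ : sumℤ (λ j → c j + δ z j * a) ≡ s
      sum≡ = trans (sumℤ-+ c (λ j → δ z j * a))
        (trans (cong (sumℤ c +_) (sumℤ-δ z (λ _ → a))) (complete s (sumℤ c)))

    splitting-isGroupIsomorphism : GroupMorphisms.IsGroupIsomorphism (AbelianGroup.rawGroup (𝓑W 𝒢))
      (AbelianGroup.rawGroup (abelianGroup +-0-abelianGroup rootedGroup)) splitting
    splitting-isGroupIsomorphism = record
      { isGroupMonomorphism = record
        { isGroupHomomorphism = record
          { isMonoidHomomorphism = record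
            { isMagmaHomomorphism = record
              { isRelHomomorphism = record
                { cong = λ {x} {y} x≈y → T≈⇒sum≡ {x} {y} x≈y , T≈⇒rooted≈ {x} {y} x≈y }
              ; homo = λ x y → sumℤ-+ x y , reflexive (λ j → x j + y j)
              }
            ; ε-homo = sumℤ-zero {k} (λ _ → 0ℤ) (λ _ → refl) , reflexive (λ _ → 0ℤ)
            }
          ; ⁻¹-homo = λ x → sumℤ-neg x , reflexive (λ j → - x j)
          }
        ; injective = λ {x} {y} (sum≡ , x≈y) → rooted≈⇒T≈ {x} {y} sum≡ x≈y
        }
      ; surjective = λ (s , c) → let x , sum≡ , x≈c = splitting-surjective s c in x , λ {w} w≈x →
          trans (T≈⇒sum≡ {w} {x} w≈x) sum≡ ,
          AbelianGroup.trans rootedGroup {w} {x} {c} (T≈⇒rooted≈ {w} {x} w≈x) x≈c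
      }
      where
      reflexive : ∀ x → rootedLaplacian ⊢ x ≈ x
      reflexive x = AbelianGroup.refl rootedGroup {x}

theorem7 : (𝒢 : ColouredSphereTriangulation) →
    (z : Fin (ColouredSphereTriangulation.k 𝒢)) →
    (treeNumber 𝒢 z ≢ 0)
    × (Σ[ 𝒞 ∈ AbelianGroup 0ℓ 0ℓ ]
    (Bijection (AbelianGroup.setoid 𝒞) (setoid (Fin (treeNumber 𝒢 z)))
    × (Σ[ φ ∈ (AbelianGroup.Carrier (𝓑W 𝒢) → AbelianGroup.Carrier (abelianGroup +-0-abelianGroup 𝒞)) ]
    (GroupMorphisms.IsGroupIsomorphism (AbelianGroup.rawGroup (𝓑W 𝒢)) (AbelianGroup.rawGroup (abelianGroup +-0-abelianGroup 𝒞)) φ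
    × (∀ x → proj₁ (φ x) ≡ augmentation 𝒢 x)))))
theorem7 𝒢 z = treeNumber-≢0 𝒢 z , rootedGroup 𝒢 z , rootedGroup-bijection 𝒢 z ,
  splitting 𝒢 z , splitting-isGroupIsomorphism 𝒢 z , λ x → refl
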